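{- Let $n\ge 9$ be an integer. In the statement "$\lambda_h(Q_{n,2})=2^{n-1}$ for every integer $h$ with $\left\lceil\frac{11\times 2^{n-1}}{48}\right\rceil\le h\le 2^{n-1}$", the lower and upper bounds on $h$ are both tight, that is: (1) for $h_0=\left\lceil\frac{11\times 2^{n-1}}{48}\right\rceil$ one has $\lambda_{h_0-1}(Q_{n,2})<2^{n-1}=\lambda_{h_0}(Q_{n,2})$; (2) for $h>2^{n-1}$ the graph $Q_{n,2}$ has no $h$-extra edge-cut (so $\lambda_h(Q_{n,2})$ is not defined).
   Context: The $(n,2)$-enhanced hypercube $Q_{n,2}$ is the graph whose vertices are all binary strings $x_nx_{n-1}\cdots x_1$ with $x_i\in\{0,1\}$. Two vertices $x=x_n\cdots x_1$ and $y$ are adjacent iff either $y$ differs from $x$ in exactly one position, or $y=x_n\bar x_{n-1}\bar x_{n-2}\cdots\bar x_1$, where $\bar x_i=1-x_i$. (It is $(n+1)$-regular with $2^n$ vertices.) For a connected graph $G$ and a positive integer $h$, an $h$-extra edge-cut is a set of edges of $G$ whose deletion yields a disconnected graph all of whose components have at least $h$ vertices. The $h$-extra edge-connectivity $\lambda_h(G)$ is the minimum cardinality of an $h$-extra edge-cut of $G$. -}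

module Defs where

open import Data.Bool.Base using (Bool; not)
open import Data.Bool.Properties using (not-involutive; not-¬)
open import Data.Fin.Base using (Fin)
open import Data.List.Base using (List; length)
import Data.List.Membership.Setoid as Membership
open import Data.List.Membership.Setoid.Properties using (∉-resp-≈)
import Data.List.Relation.Unary.Unique.Setoid as UniqueSetoid
open import Data.Nat.Base using (ℕ; pred; NonZero; _+_; _≤_; s≤s; z≤n; _/_)
open import Data.Product using (Σ-syntax; ∃-syntax; ∃!; _×_; _,_)
open import Data.Sum.Base using (_⊎_; inj₁; inj₂)
open import Data.Vec.Base using (Vec; []; _∷_; map; lookup)
open import Data.Vec.Properties using (map-id; map-∘; map-cong; ∷-injectiveʳ; ∷-injectiveˡ)
open import Function.Definitions using (Injective)
open import Relation.Binary.Bundles using (Setoid)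
open import Relation.Binary.Construct.Closure.ReflexiveTransitive using (Star)
open import Relation.Binary.PropositionalEquality
  using (_≡_; _≢_; refl; sym; trans; cong; ≢-sym)
open import Relation.Nullary.Negation.Core using (¬_)

record Graph : Set₁ where
  infix 4 _~_
  field
    Vertex   : Set
    _~_      : Vertex → Vertex → Set
    ~-sym    : ∀ {u v} → u ~ v → v ~ u
    ~-irrefl : ∀ {v} → ¬ (v ~ v)

module _ (G : Graph) where
  open Graph G

  record Edge : Set where
    constructor edge
    field
      {end₁ end₂} : Vertex
      adjacent    : end₁ ~ end₂

  open Edge

  -- An edge is an unordered pair: its orientation and the adjacency proof
  -- are ignored.
  SameEdge : Edge → Edge → Set
  SameEdge e f = (end₁ e ≡ end₁ f × end₂ e ≡ end₂ f)
               ⊎ (end₁ e ≡ end₂ f × end₂ e ≡ end₁ f)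

  edgeSetoid : Setoid _ _
  edgeSetoid = record
    { Carrier       = Edge
    ; _≈_           = SameEdge
    ; isEquivalence = record
      { refl  = inj₁ (refl , refl)
      ; sym   = λ where
          (inj₁ (p , q)) → inj₁ (sym p , sym q)
          (inj₂ (p , q)) → inj₂ (sym q , sym p)
      ; trans = λ where
          (inj₁ (p , q)) (inj₁ (r , s)) → inj₁ (trans p r , trans q s)
          (inj₁ (p , q)) (inj₂ (r , s)) → inj₂ (trans p r , trans q s)
          (inj₂ (p , q)) (inj₁ (r , s)) → inj₂ (trans p s , trans q r)
          (inj₂ (p , q)) (inj₂ (r , s)) → inj₁ (trans p s , trans q r)
      }
    }

  open Membership edgeSetoid using (_∉_)
  open UniqueSetoid edgeSetoid using (Unique)

  -- Finite sets of edges, as lists without repetition up to SameEdge, so that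
  -- the cardinality is the length of the list.
  record EdgeSet : Set where
    field
      edges  : List Edge
      unique : Unique edges

  card : EdgeSet → ℕ
  card F = length (EdgeSet.edges F)

  ∉-flip : ∀ {es u v} (a : u ~ v) → edge a ∉ es → edge (~-sym a) ∉ es
  ∉-flip a = ∉-resp-≈ edgeSetoid {x = edge a} {y = edge (~-sym a)} (inj₂ (refl , refl))

  _∖_ : EdgeSet → Graph
  _∖_ F = record
    { Vertex   = Vertex
    ; _~_      = λ u v → Σ[ a ∈ u ~ v ] edge a ∉ EdgeSet.edges F
    ; ~-sym    = λ (a , a∉) → ~-sym a , ∉-flip a a∉
    ; ~-irrefl = λ (a , _) → ~-irrefl a
    }

  Reachable : Vertex → Vertex → Set
  Reachable = Star _~_

  Connected : Set
  Connected = ∀ u v → Reachable u v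

  -- The component of v is the set of vertices reachable from v.
  ComponentHasAtLeast : ℕ → Vertex → Set
  ComponentHasAtLeast h v =
    Σ[ f ∈ (Fin h → Vertex) ] Injective _≡_ _≡_ f × (∀ i → Reachable v (f i))

IsExtraEdgeCut : (G : Graph) → ℕ → EdgeSet G → Set
IsExtraEdgeCut G h F =
    ¬ Connected (G ∖ F)
  × (∀ v → ComponentHasAtLeast (G ∖ F) h v)

-- λ_h(G) is a partial function of h, being undefined when G has no h-extra
-- edge-cut.  IsExtraEdgeConnectivity G h k says that λ_h(G) is defined and
-- equal to k.
IsExtraEdgeConnectivity : (G : Graph) → ℕ → ℕ → Set
IsExtraEdgeConnectivity G h k =
    (∃[ F ] IsExtraEdgeCut G h F × card G F ≡ k)
  × (∀ F → IsExtraEdgeCut G h F → k ≤ card G F)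

DifferInExactlyOnePosition : ∀ {n} → Vec Bool n → Vec Bool n → Set
DifferInExactlyOnePosition x y = ∃! _≡_ λ i → lookup x i ≢ lookup y i

-- The string xₙ xₙ₋₁ ⋯ x₁ is the vector whose head is xₙ.
complementTail : ∀ {n} → Vec Bool n → Vec Bool n
complementTail []       = []
complementTail (x ∷ xs) = x ∷ map not xs

complementTail-involutive : ∀ {n} (x : Vec Bool n) →
                            complementTail (complementTail x) ≡ x
complementTail-involutive []       = refl
complementTail-involutive (x ∷ xs) = cong (x ∷_)
  (trans (sym (map-∘ not not xs)) (trans (map-cong not-involutive xs) (map-id xs)))

-- The bound 2 ≤ n is needed only for irreflexivity: for n < 2 one has
-- complementTail x ≡ x.
enhancedHypercube : ∀ n → 2 ≤ n → Graph
enhancedHypercube n 2≤n = record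
  { Vertex   = Vec Bool n
  ; _~_      = λ x y → DifferInExactlyOnePosition x y ⊎ y ≡ complementTail x
  ; ~-sym    = λ where
      (inj₁ (i , x≢y , i!)) → inj₁ (i , ≢-sym x≢y , λ y≢x → i! (≢-sym y≢x))
      (inj₂ refl)           → inj₂ (sym (complementTail-involutive _))
  ; ~-irrefl = λ where
      (inj₁ (_ , x≢x , _)) → x≢x refl
      (inj₂ x≡x̄)           → x≢x̄ 2≤n _ x≡x̄
  }
  where
  x≢x̄ : ∀ {n} → 2 ≤ n → (x : Vec Bool n) → x ≢ complementTail x
  x≢x̄ (s≤s (s≤s z≤n)) (_ ∷ y ∷ _) eq = not-¬ refl (∷-injectiveˡ (∷-injectiveʳ eq))

⌈_/_⌉ : (m d : ℕ) .{{_ : NonZero d}} → ℕ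
⌈ m / d ⌉ = (m + pred d) / d

{-# OPTIONS --safe #-}

-- Idea.  With m = n - 1, Q_{n,2} is the product of K₂ with the folded cube on
-- m-bit strings.  Let θ d s be the least edge boundary of an s-set in the
-- d-cube.  For a set S in the m-cube with 2|S| ≤ 2^m, splitting along a
-- coordinate yields ∂S ≥ θ m |S| + #{x ∈ S : x̄ ∈ S}, since per antipodal pair the
-- edges gained across the split are paid for by the antipodal points of the two
-- halves.  So passing to the folded cube costs at least |S| further edges, and a
-- set of s ≤ 2^(m-1) vertices of Q_{n,2} has boundary at least 2s + θ m s, with
-- equality for initial segments; for 2^(m-1) ≤ s ≤ 2^m the boundary in the
-- ordinary cube is already at least 2^m.  As θ is self-similar (a discrete Takagi
-- function), 2s + θ m s drops below 2^m exactly when s < 11·2^m / 48 near there.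
-- Finally, one component of an h-extra edge-cut and its complement both have at
-- least h vertices, and all edges between them lie in the cut.
module Submission where

open import Defs
open import Data.Nat.Base
open import Data.Nat.Properties
open import Data.Nat.DivMod using (m≡m%n+[m/n]*n; m%n<n)
open import Data.Nat.Tactic.RingSolver using (solve)
open import Data.Product.Base using (_×_; _,_; ∃-syntax; Σ-syntax; proj₁; proj₂; map₁)
open import Data.Sum.Base using (_⊎_; inj₁; inj₂)
open import Data.Empty using (⊥-elim)
open import Relation.Binary.PropositionalEquality

-- Arithmetic of the discrete Takagi function

module Arithmetic where

  open import Data.List.Base using ([]; _∷_)

  -- Linear arithmetic without subtraction. The hypothesis `l ≤ r` is a sum of known inequalities
  -- and `K` collects the terms that cancel from it; the two equations are left to the ring solver.
  -- In the local `arith` lemmas below, values of `θ` are replaced by variables for this purpose.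
  cancel-≤ : ∀ {l r L R} K → l ≤ r → L + K ≡ l → R + K ≡ r → L ≤ R
  cancel-≤ K l≤r p q = +-cancelʳ-≤ K _ _ (subst₂ _≤_ (sym p) (sym q) l≤r)

  -- The ring solver does not see through the type of +-monoʳ-≤.
  shift-≤ : ∀ k {m n} → m ≤ n → k + m ≤ k + n
  shift-≤ = +-monoʳ-≤

  cancel-≡ : ∀ {l r L R} K → l ≡ r → L + K ≡ l → R + K ≡ r → L ≡ R
  cancel-≡ K refl p q = +-cancelʳ-≡ K _ _ (trans p (sym q))

  -- The least number of edges of the d-cube leaving a set of s ≤ 2^d vertices:
  -- θ d s / 2^d is the Takagi function at s / 2^d.
  opaque
    θ : ℕ → ℕ → ℕ
    θ zero    s = 0
    θ (suc d) s = s ⊓ (2 ^ suc d ∸ s) + θ d (s ⊓ (2 ^ suc d ∸ s))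

    θ-zero : ∀ s → θ 0 s ≡ 0
    θ-zero s = refl

    θ-sym : ∀ d {s t} → s + t ≡ 2 ^ d → θ d s ≡ θ d t
    θ-sym zero    _ = refl
    θ-sym (suc d) {s} {t} s+t≡ = cong (λ r → r + θ d r) (begin
      s ⊓ (2 ^ suc d ∸ s)  ≡⟨ cong (λ N → s ⊓ (N ∸ s)) s+t≡ ⟨
      s ⊓ (s + t ∸ s)      ≡⟨ cong (s ⊓_) (m+n∸m≡n s t) ⟩
      s ⊓ t                ≡⟨ ⊓-comm s t ⟩
      t ⊓ s                ≡⟨ cong (t ⊓_) (m+n∸n≡m s t) ⟨
      t ⊓ (s + t ∸ t)      ≡⟨ cong (λ N → t ⊓ (N ∸ t)) s+t≡ ⟩
      t ⊓ (2 ^ suc d ∸ t)  ∎)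
      where open ≡-Reasoning

    θ-low : ∀ d {s} → s ≤ 2 ^ d → θ (suc d) s ≡ s + θ d s
    θ-low d {s} s≤ = cong (λ r → r + θ d r)
      (m≤n⇒m⊓n≡m (m+n≤o⇒m≤o∸n s (+-mono-≤ s≤ (≤-trans s≤ (m≤m+n _ 0)))))

    harper-zero : ∀ {x y} → x ≤ y → y ≤ 1 → θ 1 (x + y) + x ≤ θ 0 x + θ 0 y + y
    harper-zero {zero}   {zero}     _         _         = z≤n
    harper-zero {zero}   {suc zero} _         _         = s≤s z≤n
    harper-zero {zero}   {2+ _}     _         (s≤s ())
    harper-zero {suc .0} {suc .0}   (s≤s z≤n) (s≤s z≤n) = s≤s z≤n

  θ-empty : ∀ d → θ d 0 ≡ 0
  θ-empty zero    = θ-zero 0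
  θ-empty (suc d) = trans (θ-low d z≤n) (θ-empty d)

  -- Self-similarity on the upper half: reflection in dimension `suc d` turns `2 ^ d + t` into `u`,
  -- and reflection in dimension `d` turns `u` back into `t`.
  θ-high : ∀ d {t u} → t + u ≡ 2 ^ d → θ (suc d) (2 ^ d + t) ≡ u + θ d t
  θ-high d {t} {u} t+u≡ = begin
    θ (suc d) (2 ^ d + t)  ≡⟨ θ-sym (suc d) (double t+u≡) ⟩
    θ (suc d) u            ≡⟨ θ-low d (subst (u ≤_) t+u≡ (m≤n+m u t)) ⟩
    u + θ d u              ≡⟨ cong (u +_) (θ-sym d t+u≡) ⟨
    u + θ d t              ∎
    where
    open ≡-Reasoning
    double : ∀ {N} → t + u ≡ N → N + t + u ≡ 2 * N
    double refl = solve (t ∷ u ∷ [])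

  -- In the upper half, `u` is the distance from `s` to `2 * H`. Carrying it along with `t` keeps
  -- truncated subtraction out of everything that uses `θ-high`.
  half : ∀ H {s} → s ≤ 2 * H → s ≤ H ⊎ ∃[ t ] ∃[ u ] s ≡ H + t × t + u ≡ H
  half H {s} s≤ with ≤-total s H
  ... | inj₁ s≤H = inj₁ s≤H
  ... | inj₂ H≤s = inj₂ (s ∸ H , H ∸ (s ∸ H) , sym (m+[n∸m]≡n H≤s) ,
    m+[n∸m]≡n (m≤n+o⇒m∸n≤o s H (subst (λ M → s ≤ H + M) (+-identityʳ H) s≤)))

  part≤ : ∀ {x y z} → x + y ≡ z → x ≤ z
  part≤ {x} {y} x+y≡z = subst (x ≤_) x+y≡z (m≤m+n x y)

  double≤ : ∀ {x y H} → x ≤ H → y ≤ H → x + y ≤ 2 * H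
  double≤ x≤H y≤H = +-mono-≤ x≤H (≤-trans y≤H (m≤m+n _ 0))

  double≡ : ∀ {x y x′ y′ H} → x + x′ ≡ H → y + y′ ≡ H → (x + y) + (x′ + y′) ≡ 2 * H
  double≡ {x} {y} {x′} {y′} {H} p q = cancel-≡ 0 (cong₂ _+_ p q)
    (solve (x ∷ y ∷ x′ ∷ y′ ∷ [])) (solve (H ∷ []))

  -- The edge-isoperimetric recursion θ (d+1) (x+y) ≤ θ d x + θ d y + |x - y|, with
  -- the subtraction moved across.
  Harper : ℕ → Set
  Harper d = ∀ {x y} → x ≤ y → y ≤ 2 ^ d → θ (suc d) (x + y) + x ≤ θ d x + θ d y + y

  -- By `θ-low` the left side of Harper's recursion contains the summand `x + y`; cancelling `y`
  -- leaves a gain of `2x`.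
  Harper⇒subadditive : ∀ d → Harper d → ∀ {x y} → x ≤ y → x + y ≤ 2 ^ d →
                       θ d (x + y) + (x + x) ≤ θ d x + θ d y
  Harper⇒subadditive d harper {x} {y} x≤y x+y≤ =
    arith {r = θ d x} {θ d y} (θ-low d x+y≤) (harper x≤y (≤-trans (m≤n+m y x) x+y≤))
    where
    arith : ∀ {p q r s} → p ≡ x + y + q → p + x ≤ r + s + y → q + (x + x) ≤ r + s
    arith {_} {q} {r} {s} refl h =
      cancel-≤ y h (solve (x ∷ y ∷ q ∷ [])) (solve (y ∷ r ∷ s ∷ []))

  -- This is Harper's recursion one dimension up for one argument in each half of the range. The
  -- left side is `2 * 2 ^ d` plus `θ d` of `x + y` reduced modulo `2 ^ d`; without a carry
  -- subadditivity bounds that value, with a carry Harper's recursion in dimension `d` does,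
  -- together with `y ≤ 2 ^ d`.
  Harper⇒mixed : ∀ d → Harper d → ∀ {x y} → x ≤ y → y ≤ 2 ^ d →
                 θ (2 + d) (2 ^ d + (x + y)) ≤ 2 * 2 ^ d + (θ d x + θ d y)
  Harper⇒mixed d harper {x} {y} x≤y y≤H with half (2 ^ d) (double≤ (≤-trans x≤y y≤H) y≤H)
  ... | inj₁ x+y≤H = arith (2 ^ d) {r = θ d x} {θ d y} x+y+w≡H
          (trans (θ-low (suc d) (double≤ ≤-refl x+y≤H))
                 (cong (2 ^ d + (x + y) +_) (θ-high d x+y+w≡H)))
          (Harper⇒subadditive d harper x≤y x+y≤H)
    where
    x+y+w≡H = m+[n∸m]≡n x+y≤H
    arith : ∀ H {w p q r s} → x + y + w ≡ H → p ≡ H + (x + y) + (w + q) →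
            q + (x + x) ≤ r + s → p ≤ 2 * H + (r + s)
    arith _ {w} {_} {q} {r} {s} refl refl h = cancel-≤ 0 (shift-≤ (2 * (x + y + w)) (m+n≤o⇒m≤o q h))
      (solve (x ∷ y ∷ w ∷ q ∷ [])) (solve (x ∷ y ∷ w ∷ r ∷ s ∷ []))
  ... | inj₂ (w , w′ , x+y≡ , w+w′≡H) = arith (2 ^ d) {r = θ d x} {θ d y} w+w′≡H x+y≡ y≤H
          (trans (cong (θ (2 + d)) (regroup (2 ^ d) x+y≡))
          (trans (θ-high (suc d) (total (2 ^ d) w+w′≡H))
                 (cong (w′ + 2 ^ d +_) (θ-low d (part≤ w+w′≡H)))))
          (trans (cong (θ (suc d)) x+y≡) (θ-high d w+w′≡H))
          (harper x≤y y≤H)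
    where
    regroup : ∀ H {z} → z ≡ H + w → H + z ≡ 2 * H + w
    regroup H refl = solve (H ∷ w ∷ [])
    total : ∀ H → w + w′ ≡ H → w + (w′ + H) ≡ 2 * H
    total _ refl = solve (w ∷ w′ ∷ [])
    arith : ∀ H {p q p′ r s} → w + w′ ≡ H → x + y ≡ H + w → y ≤ H →
            p ≡ w′ + H + (w + p′) → q ≡ w′ + p′ →
            q + x ≤ r + s + y → p ≤ 2 * H + (r + s)
    arith _ {_} {_} {p′} {r} {s} refl x+y≡ y≤H refl refl h =
      cancel-≤ (x + y + y) (+-mono-≤ h (+-mono-≤ (+-mono-≤ y≤H y≤H) (≤-reflexive (sym x+y≡))))
        (solve (x ∷ y ∷ w ∷ w′ ∷ p′ ∷ [])) (solve (x ∷ y ∷ w ∷ w′ ∷ r ∷ s ∷ []))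

  -- Induction on `d`, according to the halves in which `x` and `y` lie. If both lie in the same
  -- half, the three values of `θ` unfold alike and the recursion descends; the mixed case is
  -- `Harper⇒mixed`.
  harper : ∀ d → Harper d
  harper zero    x≤y y≤ = harper-zero x≤y y≤
  harper (suc d) {x} {y} x≤y y≤ with half (2 ^ d) y≤
  ... | inj₁ y≤H = arith (θ-low d (≤-trans x≤y y≤H)) (θ-low d y≤H)
                         (θ-low (suc d) (double≤ (≤-trans x≤y y≤H) y≤H)) (harper d x≤y y≤H)
    where
    arith : ∀ {p q r p′ q′ r′} → p ≡ x + p′ → q ≡ y + q′ → r ≡ x + y + r′ →
            r′ + x ≤ p′ + q′ + y → r + x ≤ p + q + y
    arith {_} {_} {_} {p′} {q′} {r′} refl refl refl h = cancel-≤ 0 (shift-≤ (x + y) h)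
      (solve (x ∷ y ∷ r′ ∷ [])) (solve (x ∷ y ∷ p′ ∷ q′ ∷ []))
  ... | inj₂ (v , v′ , refl , v+v′≡) with half (2 ^ d) (≤-trans x≤y y≤)
  ...   | inj₂ (u , u′ , refl , u+u′≡) = arith (2 ^ d) (θ-high d u+u′≡) (θ-high d v+v′≡)
            (trans (cong (θ (2 + d)) (regroup (2 ^ d))) (θ-high (suc d) (double≡ {u} {v} {u′} {v′} u+u′≡ v+v′≡)))
            (harper d (+-cancelˡ-≤ (2 ^ d) _ _ x≤y) (part≤ v+v′≡))
    where
    regroup : ∀ H → H + u + (H + v) ≡ 2 * H + (u + v)
    regroup H = solve (H ∷ u ∷ v ∷ [])
    arith : ∀ H {p q r p′ q′ r′} → p ≡ u′ + p′ → q ≡ v′ + q′ → r ≡ u′ + v′ + r′ →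
            r′ + u ≤ p′ + q′ + v → r + (H + u) ≤ p + q + (H + v)
    arith H {_} {_} {_} {p′} {q′} {r′} refl refl refl h = cancel-≤ 0 (shift-≤ (u′ + v′ + H) h)
      (solve (H ∷ u ∷ u′ ∷ v′ ∷ r′ ∷ [])) (solve (H ∷ v ∷ u′ ∷ v′ ∷ p′ ∷ q′ ∷ []))
  ...   | inj₁ x≤H = arith (2 ^ d) v+v′≡ (θ-low d x≤H) (θ-high d v+v′≡) mixed
    where
    mixed : θ (2 + d) (x + (2 ^ d + v)) ≤ 2 * 2 ^ d + (θ d x + θ d v)
    mixed with ≤-total x v
    ... | inj₁ x≤v = subst (λ s → θ (2 + d) s ≤ 2 * 2 ^ d + (θ d x + θ d v)) (regroup (2 ^ d))
                       (Harper⇒mixed d (harper d) x≤v (part≤ v+v′≡))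
      where
      regroup : ∀ H → H + (x + v) ≡ x + (H + v)
      regroup H = solve (H ∷ x ∷ v ∷ [])
    ... | inj₂ v≤x = subst₂ (λ s t → θ (2 + d) s ≤ 2 * 2 ^ d + t) (regroup (2 ^ d)) (+-comm (θ d v) (θ d x))
                       (Harper⇒mixed d (harper d) v≤x x≤H)
      where
      regroup : ∀ H → H + (v + x) ≡ x + (H + v)
      regroup H = solve (H ∷ x ∷ v ∷ [])
    arith : ∀ H {p q r p′ q′} → v + v′ ≡ H → p ≡ x + p′ → q ≡ v′ + q′ →
            r ≤ 2 * H + (p′ + q′) → r + x ≤ p + q + (H + v)
    arith _ {_} {_} {r} {p′} {q′} refl refl refl h = cancel-≤ 0 (shift-≤ x h)
      (solve (x ∷ r ∷ [])) (solve (x ∷ v ∷ v′ ∷ p′ ∷ q′ ∷ []))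

  -- Any gain `m` in subadditivity for `δ` and `y` survives as slack in Harper's recursion for
  -- `2 ^ d + δ` and `y` one dimension up.
  harper-excess : ∀ d {δ y m} → δ + y ≤ 2 ^ d → θ d (δ + y) + m ≤ θ d δ + θ d y →
                  θ (2 + d) (2 ^ d + δ + y) + m + y ≤ θ (1 + d) (2 ^ d + δ) + θ (1 + d) y + (2 ^ d + δ)
  harper-excess d {δ} {y} {m} δ+y≤H h =
    arith (2 ^ d) (m+[n∸m]≡n δ+y≤H) (θ-high d (shift (m+[n∸m]≡n δ+y≤H))) (θ-low d (≤-trans (m≤n+m y δ) δ+y≤H))
      (trans (cong (θ (2 + d)) (+-assoc (2 ^ d) δ y))
      (trans (θ-low (suc d) (double≤ ≤-refl δ+y≤H))
             (cong (2 ^ d + (δ + y) +_) (θ-high d (m+[n∸m]≡n δ+y≤H)))))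
      h
    where
    shift : ∀ {w H} → δ + y + w ≡ H → δ + (y + w) ≡ H
    shift {w} refl = solve (δ ∷ y ∷ w ∷ [])
    arith : ∀ H {w p q r p′ q′ r′} → δ + y + w ≡ H → p ≡ y + w + p′ → q ≡ y + q′ → r ≡ H + (δ + y) + (w + r′) →
            r′ + m ≤ p′ + q′ → r + m + y ≤ p + q + (H + δ)
    arith _ {w} {_} {_} {_} {p′} {q′} {r′} refl refl refl refl h = cancel-≤ 0 (shift-≤ (2 * (δ + y + w) + y) h)
      (solve (δ ∷ y ∷ w ∷ m ∷ r′ ∷ [])) (solve (δ ∷ y ∷ w ∷ p′ ∷ q′ ∷ []))

  -- For u > 2^d / 2 the antipodal inequality is applied to the complement, which
  -- loses e = 2u - 2^d; Harper's recursion has that much slack, or else 2v.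
  excess-slack : ∀ d {u v} → v ≤ u → u + v ≤ 2 ^ d → 2 ^ d ≤ u + u →
                 (∃[ e ] 2 ^ d + e ≡ u + u × θ (suc d) (u + v) + e + v ≤ θ d u + θ d v + u)
               ⊎ θ (suc d) (u + v) + (v + v) + v ≤ θ d u + θ d v + u
  -- Here `e` would be 1 and the first alternative is false, but `v` is 0, so the second is Harper's
  -- recursion itself.
  excess-slack zero {suc zero} {zero} v≤u _ _ = inj₂ (arith {θ 1 1} {θ 0 0} {θ 0 1} (harper 0 v≤u ≤-refl))
    where
    arith : ∀ {s t t′} → s + 0 ≤ t + t′ + 1 → s + 0 + 0 ≤ t′ + t + 1
    arith {s} {t} {t′} h = cancel-≤ 0 h (solve (s ∷ [])) (solve (t ∷ t′ ∷ []))
  excess-slack zero {2+ _}     {zero}  _ (s≤s ()) _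
  excess-slack zero {suc zero} {suc _} _ (s≤s ()) _
  excess-slack zero {2+ _}     {suc _} _ (s≤s ()) _
  excess-slack (suc d) {u} {v} v≤u u+v≤N N≤2u = go (u ∸ 2 ^ d) (sym (m+[n∸m]≡n H≤u))
    where
    cancel : ∀ H {δ} → H + δ + v ≤ 2 * H → δ + v ≤ H
    cancel H {δ} h = cancel-≤ H h (solve (H ∷ δ ∷ v ∷ [])) (solve (H ∷ []))
    H≤u : 2 ^ d ≤ u
    H≤u = *-cancelˡ-≤ 2 (subst (2 * 2 ^ d ≤_) (cong (u +_) (sym (+-identityʳ u))) N≤2u)
    go : ∀ δ → u ≡ 2 ^ d + δ →
           (∃[ e ] 2 ^ suc d + e ≡ u + u × θ (2 + d) (u + v) + e + v ≤ θ (suc d) u + θ (suc d) v + u)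
         ⊎ θ (2 + d) (u + v) + (v + v) + v ≤ θ (suc d) u + θ (suc d) v + u
    -- With `u` equal to `2 ^ d + δ` the loss is `e = 2δ`, while subadditivity gains twice the
    -- smaller of `δ` and `v`.
    go δ refl with δ+v≤H ← cancel (2 ^ d) u+v≤N | ≤-total δ v
    ... | inj₁ δ≤v = inj₁ (δ + δ , regroup (2 ^ d) ,
                       harper-excess d {δ} {v} δ+v≤H (Harper⇒subadditive d (harper d) δ≤v δ+v≤H))
      where
      regroup : ∀ H → 2 * H + (δ + δ) ≡ H + δ + (H + δ)
      regroup H = solve (H ∷ δ ∷ [])
    ... | inj₂ v≤δ = inj₂ (harper-excess d {δ} {v} δ+v≤H
                       (subst₂ (λ s t → θ d s + (v + v) ≤ t) (+-comm v δ) (+-comm (θ d v) (θ d δ))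
                         (Harper⇒subadditive d (harper d) v≤δ (subst (_≤ 2 ^ d) (+-comm δ v) δ+v≤H))))

  -- For the halves S, T of a set: u, v are their sizes, U, V their boundaries, D the
  -- number of edges between them that leave the set, p = |S ∩ T|, q = |S ∩ T̄|, and
  -- iu, iv the sizes of their antipodal parts.
  module _ (u v U V D p q : ℕ) where

    -- Adding the five hypotheses cancels `e`, `iu`, `iv` and both values of `θ`. The variables
    -- `iu`, `iv` and `e` are quantified here because one use puts other numbers than the antipodal
    -- sizes in their places.
    combine-bounds : ∀ s tu tv iu iv e → s + e + v ≤ tu + tv + u → tu + iu ≤ U + e → tv + iv ≤ V →
              p + p + (q + q) ≤ v + v + (iu + iv) → D + (p + p) ≡ u + v → s + (q + q) ≤ U + V + D
    combine-bounds s tu tv iu iv e h₁ h₂ h₃ h₄ h₅ =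
      cancel-≤ (e + v + tu + iu + tv + iv + p + p + u + v) (+-mono-≤ (+-mono-≤ (+-mono-≤ h₁ h₂) (+-mono-≤ h₃ h₄)) (≤-reflexive (sym h₅)))
        (solve (s ∷ tu ∷ tv ∷ u ∷ v ∷ p ∷ q ∷ iu ∷ iv ∷ e ∷ []))
        (solve (tu ∷ tv ∷ u ∷ v ∷ U ∷ V ∷ D ∷ p ∷ iu ∷ iv ∷ e ∷ []))

    -- Only the larger part can exceed half of its cube. `small` is its antipodal inequality when it
    -- does not, and `large` is the one inherited from the complement when it does.
    antipodal-step : ∀ d iu iv → v ≤ u → u + v ≤ 2 ^ d →
           D + (p + p) ≡ u + v → p + p + (q + q) ≤ v + v + (iu + iv) → p ≤ v → q ≤ v →
           θ d v + iv ≤ V → θ d u ≤ U →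
           (u + u ≤ 2 ^ d → θ d u + iu ≤ U) →
           (2 ^ d ≤ u + u → θ d u + iu + 2 ^ d ≤ U + (u + u)) →
           θ (suc d) (u + v) + (q + q) ≤ U + V + D
    antipodal-step d iu iv v≤u u+v≤N D≡ pq p≤v q≤v hV hU small large with ≤-total (u + u) (2 ^ d)
    ... | inj₁ 2u≤N = combine-bounds (θ (suc d) (u + v)) (θ d u) (θ d v) iu iv 0 classical
                        (subst (θ d u + iu ≤_) (sym (+-identityʳ U)) (small 2u≤N)) hV pq D≡
      where
      arith : ∀ {s tu tv} → s + v ≤ tv + tu + u → s + 0 + v ≤ tu + tv + u
      arith {s} {tu} {tv} h = cancel-≤ 0 h (solve (s ∷ v ∷ [])) (solve (tu ∷ tv ∷ u ∷ []))
      classical : θ (suc d) (u + v) + 0 + v ≤ θ d u + θ d v + u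
      classical = arith {tu = θ d u} {θ d v}
        (subst (λ s → θ (suc d) s + v ≤ θ d v + θ d u + u) (+-comm v u)
          (harper d v≤u (≤-trans (m≤m+n u v) u+v≤N)))
    ... | inj₂ N≤2u with excess-slack d v≤u u+v≤N N≤2u
    ...   | inj₁ (e , N+e≡ , slack) = combine-bounds (θ (suc d) (u + v)) (θ d u) (θ d v) iu iv e slack
                                        (arith (2 ^ d) N+e≡ (large N≤2u)) hV pq D≡
      where
      arith : ∀ N {w tu} → N + e ≡ w → tu + iu + N ≤ U + w → tu + iu ≤ U + e
      arith N {_} {tu} refl h = cancel-≤ N h refl (solve (U ∷ N ∷ e ∷ []))
    -- A slack of `2v` makes plain isoperimetry enough for the larger part: as `p` and `q` are at
    -- most `v`, the number `2v` can stand in for `iu` and for `e`, and 0 for `iv`.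
    ...   | inj₂ slack = combine-bounds (θ (suc d) (u + v)) (θ d u) (θ d v) (v + v) 0 (v + v) slack (+-monoˡ-≤ (v + v) hU)
                           (subst (_≤ V) (sym (+-identityʳ _)) (m+n≤o⇒m≤o (θ d v) hV))
                           (arith p≤v q≤v) D≡
      where
      arith : p ≤ v → q ≤ v → p + p + (q + q) ≤ v + v + (v + v + 0)
      arith p≤v q≤v = cancel-≤ 0 (+-mono-≤ (+-mono-≤ p≤v p≤v) (+-mono-≤ q≤v q≤v))
        (solve (p ∷ q ∷ [])) (solve (v ∷ []))

  -- The sizes at which 2s + θ reaches the power of two

  3r≤2⇒r≡0 : ∀ {r} → 3 * r ≤ 2 → r ≡ 0
  3r≤2⇒r≡0 {zero}  _ = refl
  3r≤2⇒r≡0 {suc r} h with ≤-trans (*-monoʳ-≤ 3 (s≤s (z≤n {r}))) h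
  ... | s≤s (s≤s ())

  -- For the Takagi function T this reads T(x) ≥ 2x on x ≤ 1/3. The induction takes two dimensions
  -- at a time because the endpoint 1/3 is a fixed point of x ↦ 4x - 1, which is the passage from
  -- `r` to `t` in the upper case.
  θ≥2r : ∀ j r → 3 * r ≤ 2 ^ j → 2 * r ≤ θ j r
  θ≥2r zero          r h rewrite 3r≤2⇒r≡0 {r} (≤-trans h (s≤s z≤n)) = z≤n
  θ≥2r (suc zero)    r h rewrite 3r≤2⇒r≡0 {r} h = z≤n
  θ≥2r (suc (suc j)) r h with half (2 ^ j) (r≤2J (2 ^ j) h)
    where
    r≤2J : ∀ J → 3 * r ≤ 2 * (2 * J) → r ≤ 2 * J
    r≤2J J h = *-cancelˡ-≤ 3 (≤-trans h (*-monoˡ-≤ (2 * J) {2} {3} (s≤s (s≤s z≤n))))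
  ... | inj₁ r≤J = subst (2 * r ≤_) (sym (trans (θ-low (suc j) (≤-trans r≤J (m≤m+n _ _))) (cong (r +_) (θ-low j r≤J))))
                     (cancel-≤ 0 (m≤m+n (r + r) (θ j r)) (solve (r ∷ [])) (arith (θ j r)))
    where
    arith : ∀ x → r + (r + x) + 0 ≡ r + r + x
    arith x = solve (r ∷ x ∷ [])
  ... | inj₂ (t , u , refl , t+u≡J) = arith (2 ^ j) t+u≡J
          (trans (θ-low (suc j) (+-monoʳ-≤ (2 ^ j) (≤-trans (part≤ t+u≡J) (m≤m+n _ 0))))
                 (cong (2 ^ j + t +_) (θ-high j t+u≡J)))
          (θ≥2r j t (cancel (2 ^ j) h))
    where
    cancel : ∀ J → 3 * (J + t) ≤ 2 * (2 * J) → 3 * t ≤ J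
    cancel J h = cancel-≤ (3 * J) h (solve (J ∷ t ∷ [])) (solve (J ∷ []))
    arith : ∀ J {x y} → t + u ≡ J → x ≡ J + t + (u + y) → 2 * t ≤ y → 2 * (J + t) ≤ x
    arith _ {_} {y} refl refl h = cancel-≤ 0 (shift-≤ (2 * (t + u)) h) (solve (t ∷ u ∷ [])) (solve (t ∷ u ∷ y ∷ []))

  3θ≤2^-lower : ∀ j → (∀ r → r ≤ 2 ^ j → 3 * θ j r ≤ 2 * 2 ^ j) →
                ∀ {r} → r ≤ 2 ^ suc j → 3 * θ (2 + j) r ≤ 2 * 2 ^ (2 + j)
  3θ≤2^-lower j hyp {r} r≤2J with half (2 ^ j) r≤2J
  ... | inj₁ r≤J = arith (2 ^ j) r≤J
        (trans (θ-low (suc j) r≤2J) (cong (r +_) (θ-low j r≤J))) (hyp r r≤J)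
    where
    arith : ∀ J {x y} → r ≤ J → x ≡ r + (r + y) → 3 * y ≤ 2 * J → 3 * x ≤ 2 * (2 * (2 * J))
    arith J {_} {y} r≤J refl h = cancel-≤ 0 (+-mono-≤ h (+-mono-≤ (+-mono-≤ (double≤ r≤J r≤J) (double≤ r≤J r≤J)) (double≤ r≤J r≤J)))
      (solve (r ∷ y ∷ [])) (solve (J ∷ []))
  ... | inj₂ (t , u , refl , t+u≡J) = arith (2 ^ j) t+u≡J
        (trans (θ-low (suc j) r≤2J) (cong (2 ^ j + t +_) (θ-high j t+u≡J))) (hyp t (part≤ t+u≡J))
    where
    arith : ∀ J {x y} → t + u ≡ J → x ≡ J + t + (u + y) → 3 * y ≤ 2 * J → 3 * x ≤ 2 * (2 * (2 * J))
    arith _ {_} {y} refl refl h = cancel-≤ 0 (shift-≤ (6 * (t + u)) h) (solve (t ∷ u ∷ y ∷ [])) (solve (t ∷ u ∷ []))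

  -- The maximum of the Takagi function is 2/3. Two dimensions at a time the bound reproduces
  -- itself, since 2J + 2J/3 = 8J/3 with J = `2 ^ j`; a single dimension would give only 5J/3 in
  -- place of 4J/3. The upper half follows by reflection.
  3θ≤2^ : ∀ j r → r ≤ 2 ^ j → 3 * θ j r ≤ 2 * 2 ^ j
  3θ≤2^ zero          r r≤ = subst (λ x → 3 * x ≤ 2) (sym (θ-zero r)) z≤n
  3θ≤2^ (suc zero)    r r≤ with half 1 r≤
  ... | inj₁ r≤1 = subst (λ x → 3 * x ≤ 4)
                     (sym (trans (θ-low 0 r≤1) (trans (cong (r +_) (θ-zero r)) (+-identityʳ r))))
                     (≤-trans (*-monoʳ-≤ 3 r≤1) (s≤s (s≤s (s≤s z≤n))))
  ... | inj₂ (t , u , refl , t+u≡1) = subst (λ x → 3 * x ≤ 4)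
                     (sym (trans (θ-high 0 t+u≡1) (trans (cong (u +_) (θ-zero t)) (+-identityʳ u))))
                     (≤-trans (*-monoʳ-≤ 3 (part≤ {u} {t} (trans (+-comm u t) t+u≡1))) (s≤s (s≤s (s≤s z≤n))))
  3θ≤2^ (suc (suc j)) r r≤ with half (2 ^ suc j) r≤
  ... | inj₁ r≤2J                    = 3θ≤2^-lower j (3θ≤2^ j) r≤2J
  ... | inj₂ (t , u , refl , t+u≡2J) = subst (λ x → 3 * x ≤ 2 * 2 ^ (2 + j))
          (θ-sym (2 + j) {u} {2 ^ suc j + t} (regroup (2 ^ suc j) t+u≡2J)) (3θ≤2^-lower j (3θ≤2^ j) (part≤ {u} {t} (trans (+-comm u t) t+u≡2J)))
    where
    regroup : ∀ H → t + u ≡ H → u + (H + t) ≡ 2 * H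
    regroup _ refl = solve (t ∷ u ∷ [])

  -- Put J = `2 ^ j`, so that the power of two is 16J. For s = 4J - r with r ≤ J, unfolding gives 2s
  -- + θ(s) = 16J - 2r + θ(r), so the claim becomes θ(r) ≥ 2r. The bound 11/48 says exactly 3r ≤ J,
  -- which is the range of `θ≥2r`.
  threshold-above : ∀ j s → 11 * 2 ^ (4 + j) ≤ 48 * s → 2 * s ≤ 2 ^ (4 + j) → 2 ^ (4 + j) ≤ 2 * s + θ (4 + j) s
  threshold-above j s lo hi with half (2 ^ (2 + j)) {s} (*-cancelˡ-≤ 2 hi)
  ... | inj₂ (t , u , refl , t+u≡K) = arith (2 ^ (2 + j)) t+u≡K
          (trans (θ-low (3 + j) (*-cancelˡ-≤ 2 hi)) (cong (2 ^ (2 + j) + t +_) (θ-high (2 + j) t+u≡K)))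
    where
    arith : ∀ K {x y} → t + u ≡ K → x ≡ K + t + (u + y) → 2 * (2 * K) ≤ 2 * (K + t) + x
    arith _ {_} {y} refl refl = cancel-≤ 0 (m≤m+n (4 * (t + u)) (2 * t + y)) (solve (t ∷ u ∷ [])) (solve (t ∷ u ∷ y ∷ []))
  ... | inj₁ s≤K = arith (2 ^ j) (m+[n∸m]≡n s≤K)
          (trans (θ-low (3 + j) (*-cancelˡ-≤ 2 hi)) (cong (s +_) (θ-low (2 + j) s≤K)))
          (trans (θ-sym (2 + j) (m+[n∸m]≡n s≤K))
                 (trans (θ-low (suc j) (≤-trans r≤J (m≤m+n _ _))) (cong (r +_) (θ-low j r≤J))))
          (θ≥2r j r 3r≤J)
    where
    r = 2 ^ (2 + j) ∸ s
    cancel : ∀ J {r} → s + r ≡ 2 * (2 * J) → 11 * (2 * (2 * (2 * (2 * J)))) ≤ 48 * s → 3 * r ≤ J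
    cancel J {r} s+r≡ lo = *-cancelˡ-≤ 16 (cancel-≤ (176 * J + 48 * s) (+-mono-≤ lo (≤-reflexive (cong (48 *_) s+r≡)))
      (solve (J ∷ s ∷ r ∷ [])) (solve (J ∷ s ∷ [])))
    3r≤J : 3 * r ≤ 2 ^ j
    3r≤J = cancel (2 ^ j) (m+[n∸m]≡n s≤K) lo
    r≤J : r ≤ 2 ^ j
    r≤J = ≤-trans (m≤m+n r _) 3r≤J
    arith : ∀ J {r x y z} → s + r ≡ 2 * (2 * J) → x ≡ s + (s + y) → y ≡ r + (r + z) → 2 * r ≤ z →
            2 * (2 * (2 * (2 * J))) ≤ 2 * s + x
    arith J {r} {z = z} s+r≡ refl refl h = cancel-≤ (4 * (s + r) + 2 * r) (+-mono-≤ (≤-reflexive (cong (4 *_) (sym s+r≡))) (shift-≤ (4 * (s + r)) h))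
      (solve (s ∷ r ∷ J ∷ [])) (solve (s ∷ r ∷ z ∷ []))

  -- In the same notation the claim is θ(r) < 2r, which follows from θ(r) ≤ 2J/3 once 3r > J. The
  -- constant 9 amounts to r ≤ J, which the unfolding requires.
  threshold-below : ∀ j s → 48 * s < 11 * 2 ^ (4 + j) → 9 * 2 ^ (4 + j) ≤ 48 * s → 2 * s + θ (4 + j) s < 2 ^ (4 + j)
  threshold-below j s hi lo = arith (2 ^ j) (m+[n∸m]≡n s≤K)
          (trans (θ-low (3 + j) (≤-trans s≤K (m≤m+n _ _))) (cong (s +_) (θ-low (2 + j) s≤K)))
          (trans (θ-sym (2 + j) (m+[n∸m]≡n s≤K))
                 (trans (θ-low (suc j) (≤-trans r≤J (m≤m+n _ _))) (cong (r +_) (θ-low j r≤J))))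
          (*-cancelˡ-< 3 _ _ (≤-<-trans (3θ≤2^ j r r≤J) (J<3r (2 ^ j) (m+[n∸m]≡n s≤K) hi)))
    where
    s≤K : s ≤ 2 ^ (2 + j)
    s≤K = *-cancelˡ-≤ 48 (cmp (2 ^ j) (<⇒≤ hi))
      where
      cmp : ∀ J → 48 * s ≤ 11 * (2 * (2 * (2 * (2 * J)))) → 48 * s ≤ 48 * (2 * (2 * J))
      cmp J h = ≤-trans h (cancel-≤ 0 (m≤m+n (176 * J) (16 * J)) (solve (J ∷ [])) (solve (J ∷ [])))
    r = 2 ^ (2 + j) ∸ s
    r≤J : r ≤ 2 ^ j
    r≤J = *-cancelˡ-≤ 48 (cancel (2 ^ j) (m+[n∸m]≡n s≤K) lo)
      where
      cancel : ∀ J {r} → s + r ≡ 2 * (2 * J) → 9 * (2 * (2 * (2 * (2 * J)))) ≤ 48 * s → 48 * r ≤ 48 * J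
      cancel J {r} s+r≡ lo = cancel-≤ (144 * J + 48 * s) (+-mono-≤ lo (≤-reflexive (cong (48 *_) s+r≡)))
        (solve (J ∷ s ∷ r ∷ [])) (solve (J ∷ s ∷ []))
    J<3r : ∀ J {r} → s + r ≡ 2 * (2 * J) → 48 * s < 11 * (2 * (2 * (2 * (2 * J)))) → 2 * J < 3 * (2 * r)
    J<3r J {r} s+r≡ hi = *-cancelˡ-< 8 (2 * J) (3 * (2 * r)) (cancel-≤ (176 * J + 48 * s) (+-mono-≤ hi (≤-reflexive (cong (48 *_) (sym s+r≡))))
       (solve (J ∷ s ∷ [])) (solve (J ∷ s ∷ r ∷ [])))
    arith : ∀ J {r x y z} → s + r ≡ 2 * (2 * J) → x ≡ s + (s + y) → y ≡ r + (r + z) → z < 2 * r →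
            2 * s + x < 2 * (2 * (2 * (2 * J)))
    arith J {r} {z = z} s+r≡ refl refl h = cancel-≤ (4 * (s + r)) (+-mono-≤ (≤-reflexive (cong (4 *_) s+r≡)) (shift-≤ (4 * s + 2 * r) h))
      (solve (s ∷ r ∷ z ∷ [])) (solve (s ∷ r ∷ J ∷ []))

  -- By `θ-low` the right side is `θ (suc d) s`: this is the ordinary isoperimetric bound for sets
  -- between a quarter and a half of the cube of dimension `suc d`.
  θ-quarter : ∀ d s → 2 ^ d ≤ 2 * s → s ≤ 2 ^ d → 2 ^ d ≤ s + θ d s
  θ-quarter zero    (suc s) _ _ = s≤s z≤n
  θ-quarter (suc d) s lo hi with half (2 ^ d) hi
  ... | inj₁ s≤H = subst (λ x → 2 ^ suc d ≤ s + x) (sym (θ-low d s≤H)) (≤-trans lo (arith (θ d s)))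
    where
    arith : ∀ x → 2 * s ≤ s + (s + x)
    arith x = cancel-≤ 0 (m≤m+n (2 * s) x) (solve (s ∷ [])) (solve (s ∷ x ∷ []))
  ... | inj₂ (t , u , refl , t+u≡H) = arith (2 ^ d) t+u≡H (θ-high d t+u≡H)
    where
    arith : ∀ H {x y} → t + u ≡ H → x ≡ u + y → 2 * H ≤ H + t + x
    arith _ {_} {y} refl refl = cancel-≤ 0 (m≤m+n (2 * (t + u)) y) (solve (t ∷ u ∷ [])) (solve (t ∷ u ∷ y ∷ []))

  ⌈/⌉-bounds : ∀ a → 0 < a → ∃[ s ] ⌈ a / 48 ⌉ ≡ suc s × 48 * s < a × a ≤ 48 * suc s
  ⌈/⌉-bounds a 0<a = go ((a + 47) / 48) ((a + 47) % 48) (m≡m%n+[m/n]*n (a + 47) 48) (m%n<n (a + 47) 48)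
    where
    go : ∀ q r → a + 47 ≡ r + q * 48 → r < 48 → ∃[ s ] q ≡ suc s × 48 * s < a × a ≤ 48 * suc s
    go zero    r e r<48 = ⊥-elim (<⇒≱ r<48 (subst (48 ≤_) (trans e (+-identityʳ r)) (+-monoˡ-≤ 47 0<a)))
    go (suc s) r e r<48 = s , refl , below , subst (a ≤_) (sym (*-suc 48 s)) above
      where
      below : 1 + 48 * s ≤ a
      below = cancel-≤ 47 (m+n≤o⇒n≤o r (≤-reflexive (sym e)))
        (solve (s ∷ [])) refl
      above : a ≤ 48 + 48 * s
      above = cancel-≤ (48 + r) (+-mono-≤ (≤-reflexive e) r<48)
        (solve (a ∷ r ∷ [])) (solve (r ∷ s ∷ []))

  complement-transfer : ∀ t a N s {a′ b} → a′ + s ≡ N + a → t + a′ ≤ b → t + a + N ≤ b + s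
  complement-transfer t a N s {a′} {b} e h = cancel-≤ a′ (+-mono-≤ h (≤-reflexive (sym e)))
    (solve (t ∷ a ∷ N ∷ a′ ∷ [])) (solve (b ∷ s ∷ a′ ∷ []))

  smaller-part : ∀ N {a b} → a + b ≡ N → N ≤ b + b → a + a ≤ N
  smaller-part _ {a} {b} refl h = +-monoʳ-≤ a (+-cancelʳ-≤ b a b h)

  -- The antipodal counts `is` and `it` cancel, so each half contributes its size plus its `θ`. The
  -- crossing number `x` is at least the difference of the sizes because `c ≤ t`, and that is the
  -- difference Harper's recursion asks for.
  boundary-arith : ∀ {s t us ut is it ∂s ∂t x c θs θt θst θ′} →
    us + is ≡ s → ut + it ≡ t → θs + is ≤ ∂s → θt + it ≤ ∂t → x + (c + c) ≡ s + t → c ≤ t →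
    θ′ ≡ s + t + θst → θ′ + t ≤ θt + θs + s →
    2 * (s + t) + θst ≤ us + ut + (∂s + ∂t + x)
  boundary-arith {us = us} {ut} {is} {it} {∂s} {∂t} {x} {c} {θs} {θt} {θst} refl refl h₁ h₂ h₃ h₄ refl h₅ =
    cancel-≤ (is + it + ut + it + θs + θt + c + c) (+-mono-≤ (+-mono-≤ (+-mono-≤ h₁ h₂) (+-mono-≤ h₄ h₄)) (+-mono-≤ (≤-reflexive (sym h₃)) h₅))
      (solve (us ∷ is ∷ ut ∷ it ∷ θs ∷ θt ∷ c ∷ θst ∷ [])) (solve (us ∷ is ∷ ut ∷ it ∷ θs ∷ θt ∷ c ∷ x ∷ ∂s ∷ ∂t ∷ []))

open Arithmetic

open import Algebra.Properties.CommutativeMonoid.Sum +-0-commutativeMonoid using (sum; ∑-distrib-+)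
open import Algebra.Properties.CommutativeSemigroup +-commutativeSemigroup using (interchange)
open import Data.Bool.Base using (Bool; true; false; not; _∧_)
open import Data.Bool.Properties using (not-¬; ¬-not; not-involutive; ∧-comm) renaming (_≟_ to _≟ᵇ_)
open import Data.Fin.Base using (Fin; zero; suc; inject≤)
open import Data.Fin.Properties using (injective⇒≤; inject≤-injective) renaming (_≟_ to _≟ᶠ_)
open import Data.List.Base as List using (List; []; _∷_; _++_; length)
open import Data.List.Properties using (length-++; length-map)
open import Data.List.Membership.Propositional using (_∈_; find)
open import Data.List.Membership.Propositional.Properties using (∈-map⁺; ∈-map⁻; ∈-++⁺ˡ; ∈-++⁺ʳ; ∈-++⁻; ∈-lookup)
import Data.List.Membership.Setoid as Membership
import Data.List.Membership.Setoid.Properties as MembershipProperties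
open import Data.List.Relation.Unary.All as All using (All; []; _∷_)
open import Data.List.Relation.Unary.AllPairs using ([]; _∷_)
open import Data.List.Relation.Unary.Any as Any using (here)
import Data.List.Relation.Unary.Unique.Setoid as UniqueSetoid
open import Data.List.Relation.Unary.Unique.Propositional using (Unique)
import Data.List.Relation.Unary.Unique.Propositional.Properties as Unique
open import Data.Vec.Base as Vec using (Vec; []; _∷_; lookup; replicate; updateAt)
open import Data.Vec.Properties
  using (map-id; map-∘; map-cong; lookup∘updateAt; lookup∘updateAt′; tabulate∘lookup; tabulate-cong; ∷-injectiveˡ; ∷-injectiveʳ; ≡-dec)
open import Function.Base using (_∘_; id)
open import Function.Definitions using (Injective)
open import Relation.Binary.Bundles using (Setoid)
open import Relation.Binary.Construct.Closure.ReflexiveTransitive as Star using (Star; ε; _◅_; _◅◅_; gmap; reverse)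
open import Relation.Nullary using (¬_; Dec; yes; no; does; contradiction)
open import Relation.Nullary.Decidable using (_×-dec_; _⊎-dec_; decidable-stable; ¬¬-excluded-middle)

-- The discrete cube

total : ∀ {n} → (Vec Bool n → ℕ) → ℕ
total {zero}  f = f []
total {suc n} f = total (f ∘ (false ∷_)) + total (f ∘ (true ∷_))

total-mono : ∀ {n} {f g : Vec Bool n → ℕ} → (∀ x → f x ≤ g x) → total f ≤ total g
total-mono {zero}  f≤g = f≤g []
total-mono {suc n} f≤g = +-mono-≤ (total-mono (f≤g ∘ (false ∷_))) (total-mono (f≤g ∘ (true ∷_)))

total-cong : ∀ {n} {f g : Vec Bool n → ℕ} → f ≗ g → total f ≡ total g
total-cong f≗g = ≤-antisym (total-mono (≤-reflexive ∘ f≗g)) (total-mono (≤-reflexive ∘ sym ∘ f≗g))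

total-+ : ∀ {n} (f g : Vec Bool n → ℕ) → total (λ x → f x + g x) ≡ total f + total g
total-+ {zero}  f g = refl
total-+ {suc n} f g = trans (cong₂ _+_ (total-+ (f ∘ (false ∷_)) (g ∘ (false ∷_))) (total-+ (f ∘ (true ∷_)) (g ∘ (true ∷_))))
                            (interchange (total (f ∘ (false ∷_))) (total (g ∘ (false ∷_))) _ _)

total-one : ∀ n → total {n} (λ _ → 1) ≡ 2 ^ n
total-one zero    = refl
total-one (suc n) = cong₂ _+_ (total-one n) (trans (total-one n) (sym (+-identityʳ _)))

complement : ∀ {n} → Vec Bool n → Vec Bool n
complement = Vec.map not

complement-involutive : ∀ {n} (x : Vec Bool n) → complement (complement x) ≡ x
complement-involutive x = trans (sym (map-∘ not not x)) (trans (map-cong not-involutive x) (map-id x))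

total-complement : ∀ {n} (f : Vec Bool n → ℕ) → total (f ∘ complement) ≡ total f
total-complement {zero}  f = refl
total-complement {suc n} f = trans (cong₂ _+_ (total-complement (f ∘ (true ∷_))) (total-complement (f ∘ (false ∷_))))
                                   (+-comm (total (f ∘ (true ∷_))) _)

⟦_⟧ : Bool → ℕ
⟦ false ⟧ = 0
⟦ true  ⟧ = 1

Subset : ℕ → Set
Subset n = Vec Bool n → Bool

count : ∀ {n} → Subset n → ℕ
count S = total (⟦_⟧ ∘ S)

common : ∀ {n} → Subset n → Subset n → ℕ
common S T = count (λ x → S x ∧ T x)

crossing : ∀ {n} → Subset n → Subset n → ℕ
crossing S T = common S (not ∘ T) + common T (not ∘ S)

antipodal : ∀ {n} → Subset n → ℕ
antipodal S = common S (S ∘ complement)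

flip : ∀ {n} → Fin n → Vec Bool n → Vec Bool n
flip i x = updateAt x i not

leaving : ∀ {n} → (Vec Bool n → Vec Bool n) → Subset n → Subset n
leaving σ S x = S x ∧ not (S (σ x))

∂ : ∀ {n} → Subset n → ℕ
∂ S = sum (λ i → count (leaving (flip i) S))

∂-suc : ∀ {n} (S : Subset (suc n)) → let S₀ = S ∘ (false ∷_); S₁ = S ∘ (true ∷_) in
        ∂ S ≡ ∂ S₀ + ∂ S₁ + crossing S₀ S₁
∂-suc S = trans (cong (crossing S₀ S₁ +_) (∑-distrib-+ (λ i → count (leaving (flip i) S₀)) (λ i → count (leaving (flip i) S₁))))
                (+-comm (crossing S₀ S₁) _)
  where
  S₀ = S ∘ (false ∷_)
  S₁ = S ∘ (true ∷_)

count-not : ∀ {n} (S : Subset n) → count (not ∘ S) + count S ≡ 2 ^ n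
count-not {n} S = trans (sym (total-+ (⟦_⟧ ∘ not ∘ S) (⟦_⟧ ∘ S))) (trans (total-cong (λ x → pointwise (S x))) (total-one n))
  where
  pointwise : ∀ b → ⟦ not b ⟧ + ⟦ b ⟧ ≡ 1
  pointwise false = refl
  pointwise true  = refl

crossing-comm : ∀ {n} (S T : Subset n) → crossing S T ≡ crossing T S
crossing-comm S T = +-comm (common S (not ∘ T)) _

crossing-not : ∀ {n} (S T : Subset n) → crossing (not ∘ S) (not ∘ T) ≡ crossing S T
crossing-not S T = trans (+-comm (common (not ∘ S) (not ∘ not ∘ T)) _)
  (cong₂ _+_ (total-cong (λ x → pointwise (S x) (T x))) (total-cong (λ x → pointwise (T x) (S x))))
  where
  pointwise : ∀ s t → ⟦ not t ∧ not (not s) ⟧ ≡ ⟦ s ∧ not t ⟧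
  pointwise s t = cong ⟦_⟧ (trans (∧-comm (not t) _) (cong (_∧ not t) (not-involutive s)))

∂-not : ∀ {n} (S : Subset n) → ∂ (not ∘ S) ≡ ∂ S
∂-not {zero}  S = refl
∂-not {suc n} S = begin
  ∂ (not ∘ S)                                                     ≡⟨ ∂-suc (not ∘ S) ⟩
  ∂ (not ∘ S₀) + ∂ (not ∘ S₁) + crossing (not ∘ S₀) (not ∘ S₁)    ≡⟨ cong₂ _+_ (cong₂ _+_ (∂-not S₀) (∂-not S₁)) (crossing-not S₀ S₁) ⟩
  ∂ S₀ + ∂ S₁ + crossing S₀ S₁                                    ≡⟨ ∂-suc S ⟨
  ∂ S                                                             ∎
  where
  open ≡-Reasoning
  S₀ = S ∘ (false ∷_)
  S₁ = S ∘ (true ∷_)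

crossing+common : ∀ {n} (S T : Subset n) → crossing S T + (common S T + common S T) ≡ count S + count T
crossing+common S T = begin
  total f + total g + (total h + total h)             ≡⟨ cong₂ _+_ (total-+ f g) (total-+ h h) ⟨
  total (λ x → f x + g x) + total (λ x → h x + h x)   ≡⟨ total-+ (λ x → f x + g x) (λ x → h x + h x) ⟨
  total (λ x → f x + g x + (h x + h x))               ≡⟨ total-cong (λ x → pointwise (S x) (T x)) ⟩
  total (λ x → ⟦ S x ⟧ + ⟦ T x ⟧)                     ≡⟨ total-+ (⟦_⟧ ∘ S) (⟦_⟧ ∘ T) ⟩
  count S + count T                                   ∎
  where
  open ≡-Reasoning
  f g h : Vec Bool _ → ℕ
  f x = ⟦ S x ∧ not (T x) ⟧
  g x = ⟦ T x ∧ not (S x) ⟧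
  h x = ⟦ S x ∧ T x ⟧
  pointwise : ∀ s t → ⟦ s ∧ not t ⟧ + ⟦ t ∧ not s ⟧ + (⟦ s ∧ t ⟧ + ⟦ s ∧ t ⟧) ≡ ⟦ s ⟧ + ⟦ t ⟧
  pointwise false false = refl
  pointwise false true  = refl
  pointwise true  false = refl
  pointwise true  true  = refl

common≤ : ∀ {n} (S T : Subset n) → common S T ≤ count T
common≤ S T = total-mono (λ x → pointwise (S x) (T x))
  where
  pointwise : ∀ s t → ⟦ s ∧ t ⟧ ≤ ⟦ t ⟧
  pointwise false t = z≤n
  pointwise true  t = ≤-refl

-- Antipodal pairs and antipodal isoperimetry

count-complement : ∀ {n} (S : Subset n) → count (S ∘ complement) ≡ count S
count-complement S = total-complement (⟦_⟧ ∘ S)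

common-complement : ∀ {n} (S T : Subset n) → common S (T ∘ complement) ≡ common (S ∘ complement) T
common-complement S T = trans (sym (total-complement (λ x → ⟦ S x ∧ T (complement x) ⟧)))
  (total-cong (λ x → cong (λ y → ⟦ S (complement x) ∧ T y ⟧) (complement-involutive x)))

common-comm : ∀ {n} (S T : Subset n) → common S T ≡ common T S
common-comm S T = total-cong (λ x → cong ⟦_⟧ (∧-comm (S x) (T x)))

antipodal-not : ∀ {n} (S : Subset n) → antipodal (not ∘ S) + (count S + count S) ≡ 2 ^ n + antipodal S
antipodal-not {n} S = begin
  antipodal (not ∘ S) + (count S + count S)                 ≡⟨ cong (λ k → antipodal (not ∘ S) + (count S + k)) (count-complement S) ⟨
  total f + (total g + total h)                             ≡⟨ cong (total f +_) (total-+ g h) ⟨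
  total f + total (λ x → g x + h x)                         ≡⟨ total-+ f (λ x → g x + h x) ⟨
  total (λ x → f x + (g x + h x))                           ≡⟨ total-cong (λ x → pointwise (S x) (S (complement x))) ⟩
  total (λ x → 1 + ⟦ S x ∧ S (complement x) ⟧)              ≡⟨ total-+ (λ _ → 1) (λ x → ⟦ S x ∧ S (complement x) ⟧) ⟩
  total {n} (λ _ → 1) + antipodal S                         ≡⟨ cong (_+ antipodal S) (total-one n) ⟩
  2 ^ n + antipodal S                                       ∎
  where
  open ≡-Reasoning
  f g h : Vec Bool n → ℕ
  f x = ⟦ not (S x) ∧ not (S (complement x)) ⟧
  g x = ⟦ S x ⟧
  h x = ⟦ S (complement x) ⟧
  pointwise : ∀ s t → ⟦ not s ∧ not t ⟧ + (⟦ s ⟧ + ⟦ t ⟧) ≡ 1 + ⟦ s ∧ t ⟧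
  pointwise false false = refl
  pointwise false true  = refl
  pointwise true  false = refl
  pointwise true  true  = refl

-- Replacing one copy in each doubled term by its antipodal image makes the inequality hold pair by
-- pair: if an antipodal pair has a points in `S` and b in `T`, it says ab ≤ b + [a = 2] + [b = 2].
common-bound : ∀ {n} (S T : Subset n) →
  common S T + common S T + (common S (T ∘ complement) + common S (T ∘ complement))
  ≤ count T + count T + (antipodal S + antipodal T)
common-bound S T = begin
  common S T + common S T + (common S T̄ + common S T̄)   ≡⟨ cong₂ (λ a b → common S T + a + (common S T̄ + b))
                                                             (sym (total-complement f)) (common-complement S T) ⟩
  total f + total g + (total h + total k)               ≡⟨ cong₂ _+_ (total-+ f g) (total-+ h k) ⟨
  total (λ x → f x + g x) + total (λ x → h x + k x)     ≡⟨ total-+ (λ x → f x + g x) (λ x → h x + k x) ⟨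
  total (λ x → f x + g x + (h x + k x))                 ≤⟨ total-mono (λ x → pointwise (S x) (S (complement x)) (T x) (T (complement x))) ⟩
  total (λ x → l x + m x + (o x + p x))                 ≡⟨ total-+ (λ x → l x + m x) (λ x → o x + p x) ⟩
  total (λ x → l x + m x) + total (λ x → o x + p x)     ≡⟨ cong₂ _+_ (total-+ l m) (total-+ o p) ⟩
  count T + count T̄ + (antipodal S + antipodal T)       ≡⟨ cong (λ c → count T + c + (antipodal S + antipodal T)) (count-complement T) ⟩
  count T + count T + (antipodal S + antipodal T)       ∎
  where
  open ≤-Reasoning
  T̄ = T ∘ complement
  f g h k l m o p : Vec Bool _ → ℕ
  f x = ⟦ S x ∧ T x ⟧
  g x = ⟦ S (complement x) ∧ T (complement x) ⟧
  h x = ⟦ S x ∧ T (complement x) ⟧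
  k x = ⟦ S (complement x) ∧ T x ⟧
  l x = ⟦ T x ⟧
  m x = ⟦ T (complement x) ⟧
  o x = ⟦ S x ∧ S (complement x) ⟧
  p x = ⟦ T x ∧ T (complement x) ⟧
  pointwise : ∀ s s′ t t′ → ⟦ s ∧ t ⟧ + ⟦ s′ ∧ t′ ⟧ + (⟦ s ∧ t′ ⟧ + ⟦ s′ ∧ t ⟧)
                          ≤ ⟦ t ⟧ + ⟦ t′ ⟧ + (⟦ s ∧ s′ ⟧ + ⟦ t ∧ t′ ⟧)
  pointwise false false t     t′    = z≤n
  pointwise false true  false false = ≤-refl
  pointwise false true  false true  = ≤-refl
  pointwise false true  true  false = ≤-refl
  pointwise false true  true  true  = n≤1+n 2
  pointwise true  false false false = ≤-refl
  pointwise true  false false true  = ≤-refl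
  pointwise true  false true  false = ≤-refl
  pointwise true  false true  true  = n≤1+n 2
  pointwise true  true  false false = z≤n
  pointwise true  true  false true  = ≤-refl
  pointwise true  true  true  false = ≤-refl
  pointwise true  true  true  true  = ≤-refl

-- The antipodal term is what the folding edges cannot gain: they number
-- count S - antipodal S.
AntipodalIsoperimetry : ℕ → Set
AntipodalIsoperimetry d = ∀ (S : Subset d) → count S + count S ≤ 2 ^ d → θ d (count S) + antipodal S ≤ ∂ S

module _ {d} (iso : AntipodalIsoperimetry d) where

  -- The complement is small enough for `iso` and has the same boundary and the same `θ`;
  -- `antipodal-not` converts its antipodal count.
  iso-large : ∀ (S : Subset d) → 2 ^ d ≤ count S + count S →
              θ d (count S) + antipodal S + 2 ^ d ≤ ∂ S + (count S + count S)
  iso-large S N≤2s = complement-transfer (θ d (count S)) (antipodal S) (2 ^ d) (count S + count S)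
    (antipodal-not S)
    (subst₂ (λ t b → t + antipodal (not ∘ S) ≤ b) (θ-sym d (count-not S)) (∂-not S)
      (iso (not ∘ S) (smaller-part (2 ^ d) {count (not ∘ S)} {count S} (count-not S) N≤2s)))

  antipodal⇒isoperimetry : ∀ (S : Subset d) → θ d (count S) ≤ ∂ S
  antipodal⇒isoperimetry S with ≤-total (count S + count S) (2 ^ d)
  ... | inj₁ 2s≤N = m+n≤o⇒m≤o _ (iso S 2s≤N)
  ... | inj₂ N≤2s = subst₂ _≤_ (θ-sym d (count-not S)) (∂-not S)
                      (m+n≤o⇒m≤o _ (iso (not ∘ S) (smaller-part (2 ^ d) {count (not ∘ S)} {count S} (count-not S) N≤2s)))

  antipodal-join : ∀ (S T : Subset d) → count T ≤ count S → count S + count T ≤ 2 ^ d →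
         θ (suc d) (count S + count T) + (common S (T ∘ complement) + common S (T ∘ complement))
         ≤ ∂ S + ∂ T + crossing S T
  antipodal-join S T t≤s s+t≤N = antipodal-step (count S) (count T) (∂ S) (∂ T) (crossing S T) (common S T) (common S (T ∘ complement))
    d (antipodal S) (antipodal T) t≤s s+t≤N (crossing+common S T) (common-bound S T) (common≤ S T)
    (≤-trans (common≤ S (T ∘ complement)) (≤-reflexive (count-complement T)))
    (iso T (≤-trans (+-monoˡ-≤ (count T) t≤s) s+t≤N))
    (antipodal⇒isoperimetry S) (iso S) (iso-large S)

-- Induction along the first coordinate. Antipodal points have different first bits, so the
-- antipodal count is the overlap of one half with the reflected other half, taken twice; this is
-- the term that `antipodal-join` provides, with the larger half first.
antipodal-isoperimetry : ∀ d → AntipodalIsoperimetry d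
antipodal-isoperimetry zero S h with S []
... | false = subst (λ x → x + 0 ≤ 0) (sym (θ-zero 0)) z≤n
... | true with s≤s () ← h
antipodal-isoperimetry (suc d) S h = subst (θ (suc d) (count S) + antipodal S ≤_) (sym (∂-suc S)) main
  where
  S₀ = S ∘ (false ∷_)
  S₁ = S ∘ (true ∷_)
  c≤N : count S ≤ 2 ^ d
  c≤N = *-cancelˡ-≤ 2 (subst (_≤ 2 ^ suc d) (cong (count S +_) (sym (+-identityʳ _))) h)
  q≡ : common S₁ (S₀ ∘ complement) ≡ common S₀ (S₁ ∘ complement)
  q≡ = trans (common-complement S₁ S₀) (common-comm (S₁ ∘ complement) S₀)
  main : θ (suc d) (count S₀ + count S₁) + (common S₀ (S₁ ∘ complement) + common S₁ (S₀ ∘ complement))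
         ≤ ∂ S₀ + ∂ S₁ + crossing S₀ S₁
  main with ≤-total (count S₁) (count S₀)
  ... | inj₁ le = subst (λ q → θ (suc d) (count S₀ + count S₁) + (common S₀ (S₁ ∘ complement) + q) ≤ ∂ S₀ + ∂ S₁ + crossing S₀ S₁) (sym q≡)
                    (antipodal-join (antipodal-isoperimetry d) S₀ S₁ le c≤N)
  ... | inj₂ ge = subst₂ _≤_
          (cong₂ _+_ (cong (θ (suc d)) (+-comm (count S₁) (count S₀))) (cong (_+ common S₁ (S₀ ∘ complement)) q≡))
          (cong₂ _+_ (+-comm (∂ S₁) (∂ S₀)) (crossing-comm S₁ S₀))
          (antipodal-join (antipodal-isoperimetry d) S₁ S₀ ge (subst (_≤ 2 ^ d) (+-comm (count S₀) (count S₁)) c≤N))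

isoperimetry : ∀ {d} (S : Subset d) → θ d (count S) ≤ ∂ S
isoperimetry S = antipodal⇒isoperimetry (antipodal-isoperimetry _) S

-- The boundary in the enhanced hypercube

generator : ∀ {n} → Fin (suc n) → Vec Bool n → Vec Bool n
generator zero    = complementTail
generator (suc i) = flip i

boundary : ∀ {n} → Subset n → ℕ
boundary S = sum (λ i → count (leaving (generator i) S))

unpaired : ∀ {n} → Subset n → ℕ
unpaired S = count (leaving complement S)

unpaired+antipodal : ∀ {n} (S : Subset n) → unpaired S + antipodal S ≡ count S
unpaired+antipodal S = trans (sym (total-+ (⟦_⟧ ∘ leaving complement S) (λ x → ⟦ S x ∧ S (complement x) ⟧)))
                             (total-cong (λ x → pointwise (S x) (S (complement x))))
  where
  pointwise : ∀ s t → ⟦ s ∧ not t ⟧ + ⟦ s ∧ t ⟧ ≡ ⟦ s ⟧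
  pointwise false t     = refl
  pointwise true  false = refl
  pointwise true  true  = refl

-- `complementTail` fixes the first bit and acts on each half as the full complement, so the folding
-- edges stay within the two halves.
boundary-suc : ∀ {m} (S : Subset (suc m)) → let S₀ = S ∘ (false ∷_); S₁ = S ∘ (true ∷_) in
               boundary S ≡ unpaired S₀ + unpaired S₁ + (∂ S₀ + ∂ S₁ + crossing S₀ S₁)
boundary-suc S = cong (unpaired (S ∘ (false ∷_)) + unpaired (S ∘ (true ∷_)) +_) (∂-suc S)

boundary-join : ∀ {d} (S T : Subset d) → count T ≤ count S → count S + count T ≤ 2 ^ d → count S + count S ≤ 2 ^ d →
  2 * (count S + count T) + θ d (count S + count T) ≤ unpaired S + unpaired T + (∂ S + ∂ T + crossing S T)
boundary-join {d} S T t≤s s+t≤N 2s≤N = boundary-arith {us = unpaired S} {unpaired T} {antipodal S} {antipodal T} {x = crossing S T} {common S T} {θ d (count S)} {θ d (count T)}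
   (unpaired+antipodal S) (unpaired+antipodal T) (iso S 2s≤N)
   (iso T (≤-trans (+-mono-≤ t≤s t≤s) 2s≤N)) (crossing+common S T) (common≤ S T)
   (trans (cong (θ (suc d)) (+-comm (count T) (count S))) (θ-low d s+t≤N))
   (harper d t≤s (≤-trans (m≤m+n _ _) s+t≤N))
  where
  iso = antipodal-isoperimetry d

boundary-small : ∀ {m} (S : Subset (suc m)) → 2 * count S ≤ 2 ^ m → 2 * count S + θ m (count S) ≤ boundary S
boundary-small {m} S 2s≤N = subst (2 * count S + θ m (count S) ≤_) (sym (boundary-suc S)) main
  where
  S₀ = S ∘ (false ∷_)
  S₁ = S ∘ (true ∷_)
  s = count S₀ + count S₁
  s+s≤N : s + s ≤ 2 ^ m
  s+s≤N = subst (_≤ 2 ^ m) (cong (s +_) (+-identityʳ s)) 2s≤N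
  s≤N : s ≤ 2 ^ m
  s≤N = m+n≤o⇒m≤o s s+s≤N
  main : 2 * s + θ m s ≤ unpaired S₀ + unpaired S₁ + (∂ S₀ + ∂ S₁ + crossing S₀ S₁)
  main with ≤-total (count S₁) (count S₀)
  ... | inj₁ le = boundary-join S₀ S₁ le s≤N (≤-trans (+-mono-≤ (m≤m+n (count S₀) (count S₁)) (m≤m+n (count S₀) (count S₁))) s+s≤N)
  ... | inj₂ ge = subst₂ _≤_ (cong (λ k → 2 * k + θ m k) (+-comm (count S₁) (count S₀)))
      (cong₂ _+_ (+-comm (unpaired S₁) (unpaired S₀)) (cong₂ _+_ (+-comm (∂ S₁) (∂ S₀)) (crossing-comm S₁ S₀)))
      (boundary-join S₁ S₀ ge (subst (_≤ 2 ^ m) (+-comm (count S₀) (count S₁)) s≤N)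
         (≤-trans (+-mono-≤ (m≤n+m (count S₁) (count S₀)) (m≤n+m (count S₁) (count S₀))) s+s≤N))

boundary-large : ∀ {m} (S : Subset (suc m)) → 2 ^ m ≤ 2 * count S → count S ≤ 2 ^ m → 2 ^ m ≤ boundary S
boundary-large {m} S lo hi = begin
  2 ^ m                    ≤⟨ θ-quarter m (count S) lo hi ⟩
  count S + θ m (count S)  ≡⟨ θ-low m hi ⟨
  θ (suc m) (count S)      ≤⟨ isoperimetry S ⟩
  ∂ S                      ≤⟨ m≤n+m (∂ S) (count (leaving complementTail S)) ⟩
  boundary S               ∎
  where open ≤-Reasoning

-- The s smallest strings in lexicographic order.
initial : ∀ n → ℕ → Subset n
initial zero    s []          = 0 <ᵇ s
initial (suc n) s (false ∷ x) = initial n (s ⊓ 2 ^ n) x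
initial (suc n) s (true  ∷ x) = initial n (s ∸ 2 ^ n) x

-- Sizes and boundaries of initial segments

initial-empty : ∀ n x → initial n 0 x ≡ false
initial-empty zero    []          = refl
initial-empty (suc n) (false ∷ x) = initial-empty n x
initial-empty (suc n) (true  ∷ x) rewrite 0∸n≡0 (2 ^ n) = initial-empty n x

initial-full : ∀ n x → initial n (2 ^ n) x ≡ true
initial-full zero    []          = refl
initial-full (suc n) (false ∷ x) rewrite m≥n⇒m⊓n≡n (m≤m+n (2 ^ n) (2 ^ n + 0)) = initial-full n x
initial-full (suc n) (true  ∷ x) rewrite m+n∸m≡n (2 ^ n) (2 ^ n + 0) | +-identityʳ (2 ^ n) = initial-full n x

count-initial : ∀ n {s} → s ≤ 2 ^ n → count (initial n s) ≡ s
count-initial zero    {zero}     _ = refl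
count-initial zero    {suc zero} _ = refl
count-initial zero    {2+ _}     (s≤s ())
count-initial (suc n) {s} s≤ = trans
  (cong₂ _+_ (count-initial n (m⊓n≤n s (2 ^ n))) (count-initial n (m≤n+o⇒m∸n≤o s (2 ^ n) (subst (λ N → s ≤ 2 ^ n + N) (+-identityʳ _) s≤))))
  (m⊓n+n∸m≡n′ s (2 ^ n))
  where
  m⊓n+n∸m≡n′ : ∀ m n → m ⊓ n + (m ∸ n) ≡ m
  m⊓n+n∸m≡n′ m n = trans (cong (_+ (m ∸ n)) (⊓-comm m n)) (m⊓n+n∸m≡n n m)

-- The hypothesis encodes that `T` is contained in `S`.
crossing-⊇ : ∀ {n} (S T : Subset n) → common S T ≡ count T → crossing S T + count T ≡ count S
crossing-⊇ S T c≡t = +-cancelʳ-≡ (count T) _ _ (begin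
  crossing S T + count T + count T          ≡⟨ +-assoc (crossing S T) (count T) (count T) ⟩
  crossing S T + (count T + count T)        ≡⟨ cong (λ k → crossing S T + (k + k)) c≡t ⟨
  crossing S T + (common S T + common S T)  ≡⟨ crossing+common S T ⟩
  count S + count T                         ∎)
  where open ≡-Reasoning

-- An initial segment either lies in the lower half or fills it and continues with an initial
-- segment of the upper half. The two cases reproduce `θ-low` and `θ-high`.
∂-initial : ∀ n {s} → s ≤ 2 ^ n → ∂ (initial n s) ≡ θ n s
∂-initial zero {s} _ = sym (θ-zero s)
∂-initial (suc n) {s} s≤ = trans (∂-suc (initial (suc n) s)) halves
  where
  halves : ∂ (initial n (s ⊓ 2 ^ n)) + ∂ (initial n (s ∸ 2 ^ n)) + crossing (initial n (s ⊓ 2 ^ n)) (initial n (s ∸ 2 ^ n)) ≡ θ (suc n) s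
  halves with half (2 ^ n) s≤
  ... | inj₁ s≤H rewrite m≤n⇒m⊓n≡m s≤H | m≤n⇒m∸n≡0 s≤H = begin
    ∂ S + ∂ T + crossing S T  ≡⟨ cong₂ _+_ (cong₂ _+_ (∂-initial n s≤H) (trans (∂-initial n z≤n) (θ-empty n))) crossing≡ ⟩
    θ n s + 0 + s             ≡⟨ cong (_+ s) (+-identityʳ (θ n s)) ⟩
    θ n s + s                 ≡⟨ +-comm (θ n s) s ⟩
    s + θ n s                 ≡⟨ θ-low n s≤H ⟨
    θ (suc n) s               ∎
    where
    open ≡-Reasoning
    S = initial n s
    T = initial n 0
    count≡0 : count T ≡ 0
    count≡0 = count-initial n z≤n
    crossing≡ : crossing S T ≡ s
    crossing≡ = begin
      crossing S T            ≡⟨ +-identityʳ _ ⟨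
      crossing S T + 0        ≡⟨ cong (crossing S T +_) count≡0 ⟨
      crossing S T + count T  ≡⟨ crossing-⊇ S T (trans (n≤0⇒n≡0 (≤-trans (common≤ S T) (≤-reflexive count≡0))) (sym count≡0)) ⟩
      count S                 ≡⟨ count-initial n s≤H ⟩
      s                       ∎
  ... | inj₂ (t , u , refl , t+u≡H) rewrite m≥n⇒m⊓n≡n (m≤m+n (2 ^ n) t) | m+n∸m≡n (2 ^ n) t = begin
    ∂ S + ∂ T + crossing S T  ≡⟨ cong₂ _+_ (cong₂ _+_ (trans (∂-initial n ≤-refl) (trans (θ-sym n (+-identityʳ _)) (θ-empty n))) (∂-initial n t≤H)) crossing≡ ⟩
    θ n t + u                 ≡⟨ +-comm (θ n t) u ⟩
    u + θ n t                 ≡⟨ θ-high n t+u≡H ⟨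
    θ (suc n) (2 ^ n + t)     ∎
    where
    open ≡-Reasoning
    S = initial n (2 ^ n)
    T = initial n t
    t≤H : t ≤ 2 ^ n
    t≤H = part≤ t+u≡H
    crossing≡ : crossing S T ≡ u
    crossing≡ = +-cancelʳ-≡ t _ _ (begin
      crossing S T + t        ≡⟨ cong (crossing S T +_) (count-initial n t≤H) ⟨
      crossing S T + count T  ≡⟨ crossing-⊇ S T (total-cong (λ x → cong (λ b → ⟦ b ∧ T x ⟧) (initial-full n x))) ⟩
      count S                 ≡⟨ count-initial n ≤-refl ⟩
      2 ^ n                   ≡⟨ t+u≡H ⟨
      t + u                   ≡⟨ +-comm t u ⟩
      u + t                   ∎)

boundary-initial : ∀ m {s} → s ≤ 2 ^ m → boundary (initial (suc m) s) ≡ unpaired (initial m s) + (s + θ m s)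
boundary-initial m {s} s≤N = cong₂ _+_ paired (trans (∂-initial (suc m) (≤-trans s≤N (m≤m+n _ _))) (θ-low m s≤N))
  where
  paired : unpaired (initial m (s ⊓ 2 ^ m)) + unpaired (initial m (s ∸ 2 ^ m)) ≡ unpaired (initial m s)
  paired rewrite m≤n⇒m⊓n≡m s≤N | m≤n⇒m∸n≡0 s≤N =
    trans (cong (unpaired (initial m s) +_) (m+n≡0⇒m≡0 _ (trans (unpaired+antipodal (initial m 0)) (count-initial m z≤n))))
          (+-identityʳ _)

boundary-initial-small : ∀ {m s} → 2 * s ≤ 2 ^ m → boundary (initial (suc m) s) ≡ 2 * s + θ m s
boundary-initial-small {m} {s} 2s≤N = begin
  boundary (initial (suc m) s)         ≡⟨ boundary-initial m s≤N ⟩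
  unpaired (initial m s) + (s + θ m s) ≡⟨ cong (_+ (s + θ m s)) unpaired≡ ⟩
  s + (s + θ m s)                      ≡⟨ +-assoc s s (θ m s) ⟨
  s + s + θ m s                        ≡⟨ cong (λ k → s + k + θ m s) (+-identityʳ s) ⟨
  2 * s + θ m s                        ∎
  where
  open ≡-Reasoning
  s≤N : s ≤ 2 ^ m
  s≤N = ≤-trans (m≤m+n s _) 2s≤N
  count≡ : count (initial m s) ≡ s
  count≡ = count-initial m s≤N
  antipodal≡0 : antipodal (initial m s) ≡ 0
  -- The boundary of the segment already equals `θ m s`, so antipodal isoperimetry leaves no room
  -- for a pair inside it.
  antipodal≡0 = n≤0⇒n≡0 (+-cancelˡ-≤ (θ m s) _ _ (≤-trans
    (subst (λ k → θ m k + antipodal (initial m s) ≤ ∂ (initial m s)) count≡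
      (antipodal-isoperimetry m (initial m s) (subst (λ k → k + k ≤ 2 ^ m) (sym count≡) (subst (_≤ 2 ^ m) (cong (s +_) (+-identityʳ s)) 2s≤N))))
    (≤-reflexive (trans (∂-initial m s≤N) (sym (+-identityʳ _))))))
  unpaired≡ : unpaired (initial m s) ≡ s
  unpaired≡ = begin
    unpaired (initial m s)                              ≡⟨ +-identityʳ _ ⟨
    unpaired (initial m s) + 0                          ≡⟨ cong (unpaired (initial m s) +_) antipodal≡0 ⟨
    unpaired (initial m s) + antipodal (initial m s)    ≡⟨ unpaired+antipodal (initial m s) ⟩
    count (initial m s)                                 ≡⟨ count≡ ⟩
    s                                                   ∎

-- This segment is the facet of strings with first bit `false`. It is closed under `complementTail`
-- and under all flips but the first, so exactly one edge leaves each of its vertices.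
boundary-initial-half : ∀ m → boundary (initial (suc m) (2 ^ m)) ≡ 2 ^ m
boundary-initial-half m = begin
  boundary (initial (suc m) (2 ^ m))                     ≡⟨ boundary-initial m ≤-refl ⟩
  unpaired (initial m (2 ^ m)) + (2 ^ m + θ m (2 ^ m))   ≡⟨ cong₂ (λ k l → k + (2 ^ m + l)) unpaired≡0 (trans (θ-sym m (+-identityʳ _)) (θ-empty m)) ⟩
  2 ^ m + 0                                              ≡⟨ +-identityʳ _ ⟩
  2 ^ m                                                  ∎
  where
  open ≡-Reasoning
  S = initial m (2 ^ m)
  unpaired≡0 : unpaired S ≡ 0
  unpaired≡0 = +-cancelʳ-≡ (antipodal S) _ _ (begin
    unpaired S + antipodal S  ≡⟨ unpaired+antipodal S ⟩
    count S                   ≡⟨ total-cong (λ x → cong ⟦_⟧ (eq x)) ⟩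
    antipodal S               ∎)
    where
    eq : ∀ x → S x ≡ (S x ∧ S (complement x))
    eq x rewrite initial-full m x | initial-full m (complement x) = refl

-- Listing subsets of the cube

members : ∀ {n} → Subset n → List (Vec Bool n)
members {zero}  S with S []
... | true  = [] ∷ []
... | false = []
members {suc n} S = List.map (false ∷_) (members (S ∘ (false ∷_))) ++ List.map (true ∷_) (members (S ∘ (true ∷_)))

length-members : ∀ {n} (S : Subset n) → length (members S) ≡ count S
length-members {zero} S with S []
... | true  = refl
... | false = refl
length-members {suc n} S = trans (length-++ (List.map (false ∷_) (members (S ∘ (false ∷_)))))
  (cong₂ _+_ (trans (length-map (false ∷_) (members (S ∘ (false ∷_)))) (length-members (S ∘ (false ∷_))))
             (trans (length-map (true ∷_) (members (S ∘ (true ∷_)))) (length-members (S ∘ (true ∷_)))))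

∈-members⁺ : ∀ {n} (S : Subset n) {x} → S x ≡ true → x ∈ members S
∈-members⁺ {zero}  S {[]} h with S []
∈-members⁺ {zero}  S {[]} refl | .true = here refl
∈-members⁺ {suc n} S {false ∷ x} h = ∈-++⁺ˡ (∈-map⁺ (false ∷_) (∈-members⁺ (S ∘ (false ∷_)) h))
∈-members⁺ {suc n} S {true  ∷ x} h = ∈-++⁺ʳ _ (∈-map⁺ (true ∷_) (∈-members⁺ (S ∘ (true ∷_)) h))

∈-members⁻ : ∀ {n} (S : Subset n) {x} → x ∈ members S → S x ≡ true
∈-members⁻ {zero}  S {[]} x∈ with true ← S [] = refl
∈-members⁻ {suc n} S x∈ with ∈-++⁻ (List.map (false ∷_) (members (S ∘ (false ∷_)))) x∈
... | inj₁ x∈₀ with y , y∈ , refl ← ∈-map⁻ (false ∷_) x∈₀ = ∈-members⁻ (S ∘ (false ∷_)) y∈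
... | inj₂ x∈₁ with y , y∈ , refl ← ∈-map⁻ (true ∷_) x∈₁ = ∈-members⁻ (S ∘ (true ∷_)) y∈

members-unique : ∀ {n} (S : Subset n) → Unique (members S)
members-unique {zero}  S with S []
... | true  = [] ∷ []
... | false = []
members-unique {suc n} S = Unique.++⁺
  (Unique.map⁺ ∷-injectiveʳ (members-unique (S ∘ (false ∷_))))
  (Unique.map⁺ ∷-injectiveʳ (members-unique (S ∘ (true ∷_))))
  disjoint
  where
  disjoint : ∀ {x} → ¬ (x ∈ List.map (false ∷_) (members (S ∘ (false ∷_))) × x ∈ List.map (true ∷_) (members (S ∘ (true ∷_))))
  disjoint (x∈₀ , x∈₁) with _ , _ , refl ← ∈-map⁻ (false ∷_) x∈₀ | _ , _ , () ← ∈-map⁻ (true ∷_) x∈₁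

indexed : ∀ {k n} → (Fin k → Subset n) → List (Fin k × Vec Bool n)
indexed {zero}  P = []
indexed {suc k} P = List.map (zero ,_) (members (P zero)) ++ List.map (map₁ suc) (indexed (P ∘ suc))

length-indexed : ∀ {k n} (P : Fin k → Subset n) → length (indexed P) ≡ sum (count ∘ P)
length-indexed {zero}  P = refl
length-indexed {suc k} P = trans (length-++ (List.map (zero ,_) (members (P zero))))
  (cong₂ _+_ (trans (length-map (zero ,_) (members (P zero))) (length-members (P zero)))
             (trans (length-map (map₁ suc) (indexed (P ∘ suc))) (length-indexed (P ∘ suc))))

∈-indexed⁺ : ∀ {k n} (P : Fin k → Subset n) {i x} → P i x ≡ true → (i , x) ∈ indexed P
∈-indexed⁺ P {zero}  h = ∈-++⁺ˡ (∈-map⁺ (zero ,_) (∈-members⁺ (P zero) h))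
∈-indexed⁺ P {suc i} h = ∈-++⁺ʳ _ (∈-map⁺ (map₁ suc) (∈-indexed⁺ (P ∘ suc) h))

∈-indexed⁻ : ∀ {k n} (P : Fin k → Subset n) {i x} → (i , x) ∈ indexed P → P i x ≡ true
∈-indexed⁻ {suc k} P p∈ with ∈-++⁻ (List.map (zero ,_) (members (P zero))) p∈
... | inj₁ p∈₀ with y , y∈ , refl ← ∈-map⁻ (zero ,_) p∈₀ = ∈-members⁻ (P zero) y∈
... | inj₂ p∈₁ with y , y∈ , refl ← ∈-map⁻ (map₁ suc) p∈₁ = ∈-indexed⁻ (P ∘ suc) y∈

indexed-unique : ∀ {k n} (P : Fin k → Subset n) → Unique (indexed P)
indexed-unique {zero}  P = []
indexed-unique {suc k} P = Unique.++⁺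
  (Unique.map⁺ (cong proj₂) (members-unique (P zero)))
  (Unique.map⁺ (λ where refl → refl) (indexed-unique (P ∘ suc)))
  disjoint
  where
  disjoint : ∀ {x} → ¬ (x ∈ List.map (zero ,_) (members (P zero)) × x ∈ List.map (map₁ suc) (indexed (P ∘ suc)))
  disjoint (x∈₀ , x∈₁) with _ , _ , refl ← ∈-map⁻ (zero ,_) x∈₀ | _ , _ , () ← ∈-map⁻ (map₁ suc) x∈₁

-- Counting with lists without repetition

module _ {a ℓ} (S : Setoid a ℓ) where
  open Setoid S using () renaming (Carrier to A; _≈_ to _≈ₛ_; sym to symₛ)
  private module M = Membership S
  private module U = UniqueSetoid S

  lookup-injective : ∀ {xs} → U.Unique xs → ∀ i j → List.lookup xs i ≈ₛ List.lookup xs j → i ≡ j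
  lookup-injective (_ ∷ _)    zero    zero    _  = refl
  lookup-injective (x≉ ∷ _)   zero    (suc j) eq = contradiction eq (All.lookup x≉ (∈-lookup j))
  lookup-injective (x≉ ∷ _)   (suc i) zero    eq = contradiction (symₛ eq) (All.lookup x≉ (∈-lookup i))
  lookup-injective (_ ∷ xs!)  (suc i) (suc j) eq = cong suc (lookup-injective xs! i j eq)

  unique-⊆⇒length≤ : ∀ {xs ys} → U.Unique xs → (∀ {x} → x ∈ xs → x M.∈ ys) → length xs ≤ length ys
  unique-⊆⇒length≤ {xs} {ys} xs! xs⊆ys = injective⇒≤ {f = f} f-injective
    where
    f : Fin (length xs) → Fin (length ys)
    f i = Any.index (xs⊆ys (∈-lookup {xs = xs} i))
    f-injective : Injective _≡_ _≡_ f
    f-injective {i} {j} eq = lookup-injective xs! i j (MembershipProperties.index-injective S (xs⊆ys (∈-lookup i)) (xs⊆ys (∈-lookup j)) eq)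

  -- Injectivity is asked only on `P` because an edge arises from both of its ends; for a cut, `P`
  -- selects the end inside the set.
  map-unique : ∀ {b p} {B : Set b} {P : B → Set p} {f : B → A} →
               (∀ {x y} → P x → P y → f x ≈ₛ f y → x ≡ y) → ∀ {xs} → All P xs → Unique xs → U.Unique (List.map f xs)
  map-unique inj []         []         = []
  map-unique inj (px ∷ pxs) (x∉ ∷ xs!) = tabulate-map pxs x∉ ∷ map-unique inj pxs xs!
    where
    tabulate-map : ∀ {ys} → All _ ys → All (_ ≢_) ys → All (λ z → ¬ (_ ≈ₛ z)) (List.map _ ys)
    tabulate-map []         []           = []
    tabulate-map (py ∷ pys) (x≢y ∷ x≢ys) = (x≢y ∘ inj px py) ∷ tabulate-map pys x≢ys

count≥ : ∀ {n h} (S : Subset n) (f : Fin h → Vec Bool n) → Injective _≡_ _≡_ f → (∀ i → S (f i) ≡ true) → h ≤ count S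
count≥ S f f-injective f∈ = subst (_ ≤_) (length-members S)
  (injective⇒≤ {f = λ i → Any.index (∈-members⁺ S (f∈ i))}
    (λ {i} {j} eq → f-injective (MembershipProperties.index-injective (setoid _) (∈-members⁺ S (f∈ i)) (∈-members⁺ S (f∈ j)) eq)))

choose : ∀ {n h} (S : Subset n) → h ≤ count S → Σ[ f ∈ (Fin h → Vec Bool n) ] Injective _≡_ _≡_ f × (∀ i → S (f i) ≡ true)
choose {n} {h} S h≤ = (λ i → List.lookup (members S) (inject≤ i h≤′))
  , (λ eq → inject≤-injective h≤′ h≤′ _ _ (lookup-injective (setoid _) (members-unique S) _ _ eq))
  , (λ i → ∈-members⁻ S (∈-lookup (inject≤ i h≤′)))
  where
  h≤′ : h ≤ length (members S)
  h≤′ = subst (h ≤_) (sym (length-members S)) h≤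

-- Double-negation shift, valid because the cube is finite: a universal statement over it is an
-- iterated conjunction.
¬¬-Vec : ∀ {n p} {P : Vec Bool n → Set p} → (∀ x → ¬ ¬ P x) → ¬ ¬ (∀ x → P x)
¬¬-Vec {zero}  h k = h [] λ p → k λ where [] → p
¬¬-Vec {suc n} h k = ¬¬-Vec (h ∘ (false ∷_)) λ p → ¬¬-Vec (h ∘ (true ∷_)) λ q →
  k λ where (false ∷ x) → p x
            (true  ∷ x) → q x

-- The generators as neighbours in the enhanced hypercube

flip-injective : ∀ {n} (i j : Fin n) {x} → flip i x ≡ flip j x → i ≡ j
flip-injective zero    zero    _ = refl
flip-injective zero    (suc j) {b ∷ x} eq = contradiction (sym (∷-injectiveˡ eq)) (not-¬ refl)
flip-injective (suc i) zero    {b ∷ x} eq = contradiction (∷-injectiveˡ eq) (not-¬ refl)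
flip-injective (suc i) (suc j) {b ∷ x} eq = cong suc (flip-injective i j (∷-injectiveʳ eq))

-- `complementTail` changes n - 1 ≥ 2 bits and a flip changes one. For n = 2 it would coincide with
-- the flip of the last bit.
complementTail≢flip : ∀ {n} → 3 ≤ n → (i : Fin n) (x : Vec Bool n) → complementTail x ≢ flip i x
complementTail≢flip (s≤s (s≤s (s≤s _))) zero          (a ∷ b ∷ c ∷ x) eq = not-¬ refl (∷-injectiveˡ eq)
complementTail≢flip (s≤s (s≤s (s≤s _))) (suc zero)    (a ∷ b ∷ c ∷ x) eq = not-¬ refl (sym (∷-injectiveˡ (∷-injectiveʳ (∷-injectiveʳ eq))))
complementTail≢flip (s≤s (s≤s (s≤s _))) (suc (suc i)) (a ∷ b ∷ c ∷ x) eq = not-¬ refl (sym (∷-injectiveˡ (∷-injectiveʳ eq)))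

generator-injective : ∀ {n} → 3 ≤ n → (i j : Fin (suc n)) {x : Vec Bool n} → generator i x ≡ generator j x → i ≡ j
generator-injective 3≤n zero    zero    eq = refl
generator-injective 3≤n zero    (suc j) eq = contradiction eq (complementTail≢flip 3≤n j _)
generator-injective 3≤n (suc i) zero    eq = contradiction (sym eq) (complementTail≢flip 3≤n i _)
generator-injective 3≤n (suc i) (suc j) eq = cong suc (flip-injective i j eq)

differ⇒flip : ∀ {n} {x y : Vec Bool n} → DifferInExactlyOnePosition x y → ∃[ i ] y ≡ flip i x
differ⇒flip {x = x} {y} (i , x≢y , i!) = i , (begin
  y                                ≡⟨ tabulate∘lookup y ⟨
  Vec.tabulate (lookup y)          ≡⟨ tabulate-cong pointwise ⟩
  Vec.tabulate (lookup (flip i x)) ≡⟨ tabulate∘lookup (flip i x) ⟩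
  flip i x                         ∎)
  where
  open ≡-Reasoning
  pointwise : ∀ j → lookup y j ≡ lookup (flip i x) j
  pointwise j with j ≟ᶠ i
  ... | yes refl = trans (¬-not (≢-sym x≢y)) (sym (lookup∘updateAt i x))
  ... | no  j≢i  = trans (sym (decidable-stable (lookup x j ≟ᵇ lookup y j) (λ ≢ → j≢i (sym (i! ≢)))))
                         (sym (lookup∘updateAt′ j i j≢i x))

flip-differs : ∀ {n} (i : Fin n) (x : Vec Bool n) → DifferInExactlyOnePosition x (flip i x)
flip-differs i x = i , (λ eq → not-¬ refl (trans eq (lookup∘updateAt i x))) ,
  λ {j} ≢ → decidable-stable (i ≟ᶠ j) (λ i≢j → ≢ (sym (lookup∘updateAt′ j i (≢-sym i≢j) x)))

-- Edge cuts

-- A single relation serves both sides of a cut: `b` is `true` for walks inside `S` and `false` for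
-- walks outside. Flips suffice to connect both sides of an initial segment.
FlipWithin : ∀ {n} → Subset n → Bool → Vec Bool n → Vec Bool n → Set
FlipWithin S b x y = (∃[ i ] y ≡ flip i x) × S x ≡ b × S y ≡ b

zeros : ∀ n → Vec Bool n
zeros n = replicate n false

flips-to-zeros : ∀ {n} (x : Vec Bool n) → Star (λ x y → ∃[ i ] y ≡ flip i x) x (zeros n)
flips-to-zeros []          = ε
flips-to-zeros (b ∷ x)     = clear b ◅◅ gmap (false ∷_) (λ where (i , refl) → suc i , refl) (flips-to-zeros x)
  where
  clear : ∀ b → Star (λ x y → ∃[ i ] y ≡ flip i x) (b ∷ x) (false ∷ x)
  clear false = ε
  clear true  = (zero , refl) ◅ ε

-- Clearing the first bit does not leave an initial segment: its upper half is nonempty only when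
-- its lower half is full.
initial-suc : ∀ n s {x} → initial n (s ∸ 2 ^ n) x ≡ true → initial n (s ⊓ 2 ^ n) x ≡ true
initial-suc n s {x} h with ≤-total s (2 ^ n)
... | inj₁ s≤N rewrite m≤n⇒m∸n≡0 s≤N = contradiction (trans (sym h) (initial-empty n x)) λ ()
... | inj₂ N≤s rewrite m≥n⇒m⊓n≡n N≤s = initial-full n x

initial-connected : ∀ n s {x} → initial n s x ≡ true → Star (FlipWithin (initial n s) true) x (zeros n)
initial-connected zero    s {[]}        h = ε
initial-connected (suc n) s {b ∷ x} h = descend b h
  where
  lower : initial n (s ⊓ 2 ^ n) x ≡ true → Star (FlipWithin (initial (suc n) s) true) (false ∷ x) (zeros (suc n))
  lower h = gmap (false ∷_) (λ where ((i , refl) , p , q) → (suc i , refl) , p , q) (initial-connected n (s ⊓ 2 ^ n) h)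
  descend : ∀ b → initial (suc n) s (b ∷ x) ≡ true → Star (FlipWithin (initial (suc n) s) true) (b ∷ x) (zeros (suc n))
  descend false h = lower h
  descend true  h = ((zero , refl) , h , initial-suc n s h) ◅ lower (initial-suc n s h)

initial-upper : ∀ {m s} → s ≤ 2 ^ m → ∀ x → initial (suc m) s (true ∷ x) ≡ false
initial-upper {m} s≤N x rewrite m≤n⇒m∸n≡0 s≤N = initial-empty m x

-- The complement contains the whole facet with first bit `true`, which flips connect; every other
-- point of the complement enters that facet by its first flip.
initial-coconnected : ∀ {m s} → s ≤ 2 ^ m → ∀ {x} → initial (suc m) s x ≡ false →
                      Star (FlipWithin (initial (suc m) s) false) x (true ∷ zeros m)
initial-coconnected {m} {s} s≤N {true  ∷ x} h =
  gmap (true ∷_) lift (flips-to-zeros x)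
  where
  lift : ∀ {x y} → ∃[ i ] y ≡ flip i x → FlipWithin (initial (suc m) s) false (true ∷ x) (true ∷ y)
  lift (i , refl) = (suc i , refl) , initial-upper {m} s≤N _ , initial-upper {m} s≤N _
initial-coconnected {m} {s} s≤N {false ∷ x} h =
  ((zero , refl) , h , initial-upper s≤N x) ◅ initial-coconnected s≤N (initial-upper s≤N x)

initial-zeros : ∀ n {s} → 0 < s → initial n s (zeros n) ≡ true
initial-zeros zero    {suc s} _ = refl
initial-zeros (suc n) {s} 0<s = initial-zeros n (⊓-pres-m< 0<s (m^n>0 2 n))

module _ {n} (2≤n : 2 ≤ n) (3≤n : 3 ≤ n) where

  private
    Q = enhancedHypercube n 2≤n
  open Graph Q

  adjacent-generator : ∀ i x → x ~ generator i x
  adjacent-generator zero    x = inj₂ refl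
  adjacent-generator (suc i) x = inj₁ (flip-differs i x)

  adjacent⇒generator : ∀ {x y} → x ~ y → ∃[ i ] y ≡ generator i x
  adjacent⇒generator (inj₁ d) with i , eq ← differ⇒flip d = suc i , eq
  adjacent⇒generator (inj₂ eq) = zero , eq

  toEdge : Fin (suc n) × Vec Bool n → Edge Q
  toEdge (i , x) = edge (adjacent-generator i x)

  module E = Membership (edgeSetoid Q)

  leaves : Subset n → Fin (suc n) → Subset n
  leaves S i = leaving (generator i) S

  leaving⁻ : ∀ S {i x} → leaves S i x ≡ true → S x ≡ true × S (generator i x) ≡ false
  leaving⁻ S {i} {x} h with true ← S x | false ← S (generator i x) = refl , refl

  leaving⁺ : ∀ S {i x} → S x ≡ true → S (generator i x) ≡ false → leaves S i x ≡ true
  leaving⁺ S p q rewrite p | q = refl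

  cutEdges : Subset n → List (Edge Q)
  cutEdges S = List.map toEdge (indexed (leaves S))

  toEdge-injective : ∀ S {p q} → leaves S (proj₁ p) (proj₂ p) ≡ true → leaves S (proj₁ q) (proj₂ q) ≡ true →
                     SameEdge Q (toEdge p) (toEdge q) → p ≡ q
  toEdge-injective S {i , x} {j , .x} _ _ (inj₁ (refl , eq)) = cong (_, x) (generator-injective 3≤n i j eq)
  toEdge-injective S {i , x} {j , y} hp hq (inj₂ (refl , _)) =
    contradiction (trans (sym (proj₁ (leaving⁻ S {i} hp))) (proj₂ (leaving⁻ S {j} {y} hq))) λ ()

  cut : Subset n → EdgeSet Q
  cut S = record
    { edges  = cutEdges S
    ; unique = map-unique (edgeSetoid Q) (toEdge-injective S)
                 (All.tabulate (∈-indexed⁻ (leaves S))) (indexed-unique (leaves S))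
    }

  card-cut : ∀ S → card Q (cut S) ≡ boundary S
  card-cut S = trans (length-map toEdge (indexed (leaves S))) (length-indexed (leaves S))

  -- In this form the condition is immediate for components. That `F` then contains every edge
  -- leaving `S` follows by contradiction, membership in `F` being decidable.
  Saturated : EdgeSet Q → Subset n → Set
  Saturated F S = ∀ {x y} → Graph._~_ (_∖_ Q F) x y → S x ≡ S y

  _∈E?_ : ∀ e es → Dec (e E.∈ es)
  e ∈E? es = Any.any? (sameEdge? e) es
    where
    _≟ᵛ_ : (x y : Vec Bool n) → Dec (x ≡ y)
    _≟ᵛ_ = ≡-dec _≟ᵇ_
    sameEdge? : ∀ e f → Dec (SameEdge Q e f)
    sameEdge? e f = (Edge.end₁ e ≟ᵛ Edge.end₁ f ×-dec Edge.end₂ e ≟ᵛ Edge.end₂ f)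
              ⊎-dec (Edge.end₁ e ≟ᵛ Edge.end₂ f ×-dec Edge.end₂ e ≟ᵛ Edge.end₁ f)

  boundary≤card : ∀ F S → Saturated F S → boundary S ≤ card Q F
  boundary≤card F S saturated = subst (_≤ card Q F) (card-cut S)
    (unique-⊆⇒length≤ (edgeSetoid Q) (EdgeSet.unique (cut S)) inF)
    where
    inF : ∀ {e} → e ∈ cutEdges S → e E.∈ EdgeSet.edges F
    inF e∈ with (i , x) , p∈ , refl ← ∈-map⁻ toEdge e∈ =
      decidable-stable (toEdge (i , x) ∈E? EdgeSet.edges F) λ e∉F →
        let Sx , Sy = leaving⁻ S {i} {x} (∈-indexed⁻ (leaves S) p∈) in
        contradiction (trans (sym Sx) (trans (saturated (adjacent-generator i x , e∉F)) Sy)) λ ()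

  -- Reachability in Q ∖ F is not decidable a priori, hence the double negation; it
  -- is harmless because the conclusions drawn are stable.
  cut⇒subset : ∀ {p} {P : Set p} {h F} → IsExtraEdgeCut Q h F →
    (∀ S → h ≤ count S → boundary S ≤ card Q F → h ≤ count (not ∘ S) → boundary (not ∘ S) ≤ card Q F → P) → ¬ ¬ P
  cut⇒subset {h = h} {F} (disconnected , large) k ¬P = ¬¬-Vec (λ u → ¬¬-Vec λ v → ¬¬-excluded-middle) λ reachable? →
    disconnected λ u v → connected reachable? u v
    where
    Reach = Reachable (_∖_ Q F)
    module _ (reachable? : ∀ u v → Dec (Reach u v)) where
      component : Vec Bool n → Subset n
      component u x = does (reachable? u x)

      component⁺ : ∀ {u x} → Reach u x → component u x ≡ true
      component⁺ {u} {x} r with reachable? u x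
      ... | yes _ = refl
      ... | no ¬r = contradiction r ¬r

      ∉component⁺ : ∀ {u x} → ¬ Reach u x → component u x ≡ false
      ∉component⁺ {u} {x} ¬r with reachable? u x
      ... | yes r = contradiction r ¬r
      ... | no _  = refl

      saturated : ∀ u → Saturated F (component u)
      saturated u {x} {y} x~y with reachable? u x
      ... | yes r = sym (component⁺ (r ◅◅ x~y ◅ ε))
      ... | no ¬r = sym (∉component⁺ (λ r → ¬r (r ◅◅ Graph.~-sym (_∖_ Q F) x~y ◅ ε)))

      connected : ∀ u v → Reach u v
      connected u v with reachable? u v
      ... | yes r = r
      -- Since `v` is not reachable from `u`, its component lies in the complement of that of `u`,
      -- so both sides have at least `h` vertices.
      ... | no ¬r with f , f-inj , f-reach ← large u | g , g-inj , g-reach ← large v = ⊥-elim (¬P (k (component u)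
              (count≥ (component u) f f-inj (λ i → component⁺ (f-reach i)))
              (boundary≤card F (component u) (saturated u))
              (count≥ (not ∘ component u) g g-inj (λ i → cong not (∉component⁺ λ r →
                 ¬r (r ◅◅ reverse (λ {x} {y} → Graph.~-sym (_∖_ Q F) {x} {y}) (g-reach i)))))
              (boundary≤card F (not ∘ component u) (cong not ∘ saturated u))))

  cut-separates : ∀ S {x y} → Graph._~_ (_∖_ Q (cut S)) x y → S x ≡ true → S y ≡ true
  cut-separates S {x} {y} (x~y , x~y∉) Sx with S y in Sy
  ... | true  = refl
  ... | false with i , refl ← adjacent⇒generator x~y = contradiction
          (Any.map (λ where refl → inj₁ (refl , refl)) (∈-map⁺ toEdge (∈-indexed⁺ (leaves S) {i} {x} (leaving⁺ S {i} Sx Sy))))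
          x~y∉

  cut-keeps : ∀ S {x y} → x ~ y → S x ≡ S y → Graph._~_ (_∖_ Q (cut S)) x y
  cut-keeps S {x} {y} x~y Sx≡Sy = x~y , λ xy∈ → crossing-edge (find xy∈)
    where
    crossing-edge : ¬ (∃[ e ] e ∈ cutEdges S × SameEdge Q (edge x~y) e)
    crossing-edge (_ , e∈ , same) with (i , z) , p∈ , refl ← ∈-map⁻ toEdge e∈
      with Sz , Sσz ← leaving⁻ S {i} {z} (∈-indexed⁻ (leaves S) p∈) | same
    ... | inj₁ (refl , refl) = contradiction (trans (sym Sz) (trans Sx≡Sy Sσz)) λ ()
    ... | inj₂ (refl , refl) = contradiction (trans (sym Sz) (trans (sym Sx≡Sy) Sσz)) λ ()

  flips⇒reachable : ∀ S b {x y} → Star (FlipWithin S b) x y → Reachable (_∖_ Q (cut S)) x y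
  flips⇒reachable S b = Star.map keep
    where
    keep : ∀ {x y} → FlipWithin S b x y → Graph._~_ (_∖_ Q (cut S)) x y
    keep {x} ((i , refl) , Sx , Sy) = cut-keeps S (adjacent-generator (suc i) x) (trans Sx (sym Sy))

  cut-isExtraEdgeCut : ∀ {h} S c c′ → S c ≡ true → S c′ ≡ false →
    (∀ {x} → S x ≡ true → Star (FlipWithin S true) x c) →
    (∀ {x} → S x ≡ false → Star (FlipWithin S false) x c′) →
    h ≤ count S → h ≤ count (not ∘ S) → IsExtraEdgeCut Q h (cut S)
  cut-isExtraEdgeCut {h} S c c′ Sc Sc′ inside outside h≤S h≤S′ =
    (λ connected → contradiction (trans (sym (stays (connected c c′) Sc)) Sc′) λ ()) , large
    where
    Q∖ = _∖_ Q (cut S)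
    stays : ∀ {x y} → Reachable Q∖ x y → S x ≡ true → S y ≡ true
    stays ε       Sx = Sx
    stays (s ◅ r) Sx = stays r (cut-separates S s Sx)
    via : ∀ {b x y c} → Star (FlipWithin S b) x c → Star (FlipWithin S b) y c → Reachable Q∖ x y
    via p q = flips⇒reachable S _ p ◅◅ reverse (λ {x} {y} → Graph.~-sym Q∖ {x} {y}) (flips⇒reachable S _ q)
    large : ∀ v → ComponentHasAtLeast Q∖ h v
    large v with S v in Sv
    ... | true  with f , f-inj , f∈ ← choose S h≤S =
            f , f-inj , λ i → via (inside Sv) (inside (f∈ i))
    ... | false with f , f-inj , f∈ ← choose (not ∘ S) h≤S′ =
            f , f-inj , λ i → via (outside Sv) (outside (trans (sym (not-involutive _)) (cong not (f∈ i))))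

-- The extra edge-connectivities

half-or-less : ∀ {h k l M} → k + l ≡ 2 * M → h ≤ k → h ≤ l → (h ≤ k × k ≤ M) ⊎ (h ≤ l × l ≤ M)
half-or-less {h} {k} {l} {M} k+l≡ h≤k h≤l with ≤-total k M
... | inj₁ k≤M = inj₁ (h≤k , k≤M)
... | inj₂ M≤k = inj₂ (h≤l , +-cancelˡ-≤ M l M (≤-trans (+-monoˡ-≤ l M≤k) (≤-reflexive (trans k+l≡ (cong (M +_) (+-identityʳ M))))))

-- The two hypotheses say that `suc s` is the ceiling h₀ for n = 5 + j, so `s` is h₀ - 1.
module _ j {s} (below : 48 * s < 11 * 2 ^ (4 + j)) (above : 11 * 2 ^ (4 + j) ≤ 48 * suc s) where

  private
    m = 4 + j

  -- Up to a quarter of all vertices the folded bound is past its threshold; from a quarter to a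
  -- half the ordinary cube already gives `2 ^ m`.
  half-boundary : ∀ (S : Subset (suc m)) → suc s ≤ count S → count S ≤ 2 ^ m → 2 ^ m ≤ boundary S
  half-boundary S s< hi with ≤-total (2 * count S) (2 ^ m)
  ... | inj₁ small = ≤-trans (threshold-above j (count S) (≤-trans above (*-monoʳ-≤ 48 s<)) small) (boundary-small S small)
  ... | inj₂ large = boundary-large S large hi

  2s≤2^m : 2 * s ≤ 2 ^ m
  2s≤2^m = *-cancelˡ-≤ 24 (≤-trans (≤-reflexive (sym (*-assoc 24 2 s))) (≤-trans (<⇒≤ below) (*-monoˡ-≤ (2 ^ m) (m≤m+n 11 13))))

  module _ (4≤j : 4 ≤ j) where

    9*2^m≤48s : 9 * 2 ^ m ≤ 48 * s
    9*2^m≤48s = +-cancelʳ-≤ 48 _ _ (begin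
      -- Passing from `suc s` to `s` costs 48, which the gap between 11 and 9 absorbs: m ≥ 8 gives 2
      -- * 2 ^ m ≥ 512 = 48 + 464.
      9 * 2 ^ m + 48          ≤⟨ +-monoʳ-≤ (9 * 2 ^ m) (≤-trans (m≤m+n 48 464) (*-monoʳ-≤ 2 (^-monoʳ-≤ 2 (+-monoʳ-≤ 4 4≤j)))) ⟩
      9 * 2 ^ m + 2 * 2 ^ m   ≡⟨ *-distribʳ-+ (2 ^ m) 9 2 ⟨
      11 * 2 ^ m              ≤⟨ above ⟩
      48 * suc s              ≡⟨ *-suc 48 s ⟩
      48 + 48 * s             ≡⟨ +-comm 48 (48 * s) ⟩
      48 * s + 48             ∎)
      where open ≤-Reasoning

    0<s : 0 < s
    0<s = *-cancelˡ-< 48 0 s (≤-trans (*-mono-≤ {1} {9} (s≤s z≤n) (m^n>0 2 m)) 9*2^m≤48s)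

    minimum<2^m : 2 * s + θ m s < 2 ^ m
    minimum<2^m = threshold-below j s below 9*2^m≤48s

    -- A cut may also split off more than `s` vertices. From `suc s` on the boundary is at least
    -- `2 ^ m`, which exceeds the value at `s`, so the minimum over all admissible sizes sits at
    -- `s`.
    minimum≤boundary : ∀ (S : Subset (suc m)) → s ≤ count S → count S ≤ 2 ^ m → 2 * s + θ m s ≤ boundary S
    minimum≤boundary S s≤ hi with m≤n⇒m<n∨m≡n s≤
    ... | inj₁ s<   = ≤-trans (<⇒≤ minimum<2^m) (half-boundary S s< hi)
    ... | inj₂ s≡ = subst (λ k → 2 * k + θ m k ≤ boundary S) (sym s≡) (boundary-small S (subst (λ k → 2 * k ≤ 2 ^ m) s≡ 2s≤2^m))

module _ {m} (2≤n : 2 ≤ suc m) (3≤n : 3 ≤ suc m) where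

  private
    Q = enhancedHypercube (suc m) 2≤n

  -- One of the two sides given by `cut⇒subset` has at most half of the vertices, and the double
  -- negation goes because `≤` is decidable.
  lower-bound : ∀ {h k} → (∀ (S : Subset (suc m)) → h ≤ count S → count S ≤ 2 ^ m → k ≤ boundary S) →
                ∀ F → IsExtraEdgeCut Q h F → k ≤ card Q F
  lower-bound {h} {k} bound F isCut = decidable-stable (k ≤? card Q F) (cut⇒subset 2≤n 3≤n {h = h} {F} isCut smaller)
    where
    smaller : ∀ S → h ≤ count S → boundary S ≤ card Q F → h ≤ count (not ∘ S) → boundary (not ∘ S) ≤ card Q F → k ≤ card Q F
    smaller S h≤S S≤F h≤S′ S′≤F with half-or-less (trans (+-comm (count S) (count (not ∘ S))) (count-not S)) h≤S h≤S′
    ... | inj₁ (lo , hi) = ≤-trans (bound S lo hi) S≤F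
    ... | inj₂ (lo , hi) = ≤-trans (bound (not ∘ S) lo hi) S′≤F

  no-large-cut : ∀ {h} → 2 ^ m < h → ¬ (∃[ F ] IsExtraEdgeCut Q h F)
  no-large-cut {h} 2^m<h (F , isCut) = cut⇒subset 2≤n 3≤n {h = h} {F} isCut
    (λ S h≤S _ h≤S′ _ → <⇒≱ (+-mono-< (<-≤-trans 2^m<h h≤S′) (<-≤-trans 2^m<h h≤S))
      (≤-reflexive (trans (count-not S) (cong (2 ^ m +_) (+-identityʳ _))))) id

  initial-cut : ∀ {s} → 0 < s → s ≤ 2 ^ m → IsExtraEdgeCut Q s (cut 2≤n 3≤n (initial (suc m) s))
  initial-cut {s} 0<s s≤N = cut-isExtraEdgeCut 2≤n 3≤n S (zeros (suc m)) (true ∷ zeros m)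
    (initial-zeros (suc m) 0<s) (initial-upper s≤N (zeros m))
    (initial-connected (suc m) s) (initial-coconnected s≤N)
    (≤-reflexive (sym count≡))
    (+-cancelʳ-≤ s _ _ (begin
      s + s                      ≤⟨ double≤ s≤N s≤N ⟩
      2 ^ suc m                  ≡⟨ count-not S ⟨
      count (not ∘ S) + count S  ≡⟨ cong (count (not ∘ S) +_) count≡ ⟩
      count (not ∘ S) + s        ∎))
    where
    open ≤-Reasoning
    S = initial (suc m) s
    count≡ : count S ≡ s
    count≡ = count-initial (suc m) (≤-trans s≤N (m≤m+n _ _))

  weaken : ∀ {h h′ F} → h ≤ h′ → IsExtraEdgeCut Q h′ F → IsExtraEdgeCut Q h F
  weaken h≤h′ (disconnected , large) = disconnected , λ v → let f , f-inj , reach = large v in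
    (λ i → f (inject≤ i h≤h′)) , (λ eq → inject≤-injective h≤h′ h≤h′ _ _ (f-inj eq)) , λ i → reach (inject≤ i h≤h′)

  -- The segment may be larger than `h`: for h₀ the optimal cut is that of the facet of size
  -- `2 ^ m`, for h₀ - 1 that of a segment of exactly this size.
  initial-extraEdgeConnectivity : ∀ {h s} → h ≤ s → 0 < s → s ≤ 2 ^ m →
    (∀ (S : Subset (suc m)) → h ≤ count S → count S ≤ 2 ^ m → boundary (initial (suc m) s) ≤ boundary S) →
    IsExtraEdgeConnectivity Q h (boundary (initial (suc m) s))
  initial-extraEdgeConnectivity {h} {s} h≤s 0<s s≤N bound =
    (F , weaken {F = F} h≤s (initial-cut 0<s s≤N) , card-cut 2≤n 3≤n (initial (suc m) s)) , lower-bound bound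
    where
    F = cut 2≤n 3≤n (initial (suc m) s)

extraEdgeConnectivities : ∀ j {s} (2≤n : 2 ≤ 5 + j) → let Q = enhancedHypercube (5 + j) 2≤n in
  4 ≤ j → 48 * s < 11 * 2 ^ (4 + j) → 11 * 2 ^ (4 + j) ≤ 48 * suc s →
  (∃[ k ] IsExtraEdgeConnectivity Q s k × k < 2 ^ (4 + j)) × IsExtraEdgeConnectivity Q (suc s) (2 ^ (4 + j))
extraEdgeConnectivities j {s} 2≤n 4≤j below above =
    (boundary (initial (suc m) s)
    , initial-extraEdgeConnectivity 2≤n 3≤n ≤-refl (0<s j below above 4≤j) s≤2^m
        (λ S lo hi → subst (_≤ boundary S) (sym minimum≡) (minimum≤boundary j below above 4≤j S lo hi))
    , subst (_< 2 ^ m) (sym minimum≡) (minimum<2^m j below above 4≤j))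
  , subst (IsExtraEdgeConnectivity (enhancedHypercube (suc m) 2≤n) (suc s)) (boundary-initial-half m)
      (initial-extraEdgeConnectivity 2≤n 3≤n s<2^m (m^n>0 2 m) ≤-refl
        (λ S lo hi → subst (_≤ boundary S) (sym (boundary-initial-half m)) (half-boundary j below above S lo hi)))
  where
  m = 4 + j
  3≤n : 3 ≤ 5 + j
  3≤n = m≤m+n 3 (2 + j)
  minimum≡ : boundary (initial (suc m) s) ≡ 2 * s + θ m s
  minimum≡ = boundary-initial-small (2s≤2^m j below above)
  s<2^m : s < 2 ^ m
  s<2^m = *-cancelˡ-< 48 s (2 ^ m) (<-≤-trans below (*-monoˡ-≤ (2 ^ m) (m≤m+n 11 37)))
  s≤2^m : s ≤ 2 ^ m
  s≤2^m = <⇒≤ s<2^m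

mainTheorem2 : ∀ (n : ℕ) (9≤n : 9 ≤ n) →
    let Q  = enhancedHypercube n (≤-trans (m≤m+n 2 7) 9≤n)
        h₀ = ⌈ 11 * 2 ^ (n ∸ 1) / 48 ⌉
    in ( (∃[ k ] IsExtraEdgeConnectivity Q (h₀ ∸ 1) k × k < 2 ^ (n ∸ 1))
    × IsExtraEdgeConnectivity Q h₀ (2 ^ (n ∸ 1)) )
    × (∀ (h : ℕ) → h > 2 ^ (n ∸ 1) → ¬ (∃[ F ] IsExtraEdgeCut Q h F))
mainTheorem2 n 9≤n
  -- Writing n = 5 + j makes 2 ^ (n - 1) equal to 16 * 2 ^ j, the scale of the threshold lemmas; n ≥
  -- 9 becomes j ≥ 4.
  with j , refl ← m≤n⇒∃[o]m+o≡n (≤-trans (m≤m+n 5 4) 9≤n)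
  with s , h₀≡ , below , above ← ⌈/⌉-bounds (11 * 2 ^ (4 + j)) (*-mono-≤ {1} {11} (s≤s z≤n) (m^n>0 2 (4 + j))) =
    subst (λ h₀ → (∃[ k ] IsExtraEdgeConnectivity Q (h₀ ∸ 1) k × k < 2 ^ (4 + j)) × IsExtraEdgeConnectivity Q h₀ (2 ^ (4 + j)))
      (sym h₀≡) (extraEdgeConnectivities j 2≤n (+-cancelˡ-≤ 5 4 j 9≤n) below above)
  , λ h → no-large-cut 2≤n (m≤m+n 3 (2 + j))
  where
  2≤n = ≤-trans (m≤m+n 2 7) 9≤n
  Q   = enhancedHypercube _ 2≤n
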